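{- Let $d$ be a natural number and $\varepsilon, \alpha$ positive real numbers. Let $H$ be a bipartite graph on $n$ vertices with a vertex partition $W_1 \cup W_2$ into independent sets where every vertex in $W_1$ has at most $d$ neighbors in $W_2$. Let $G$ be a bipartite graph with vertex partition $V_1 \cup V_2$ (into independent sets) of density at least $\alpha$, where $|V_1| \ge (1+\varepsilon)\alpha^{ -d} |W_1|$ and $|V_2| \ge \left(\frac{1+\varepsilon}{\varepsilon}\right)^{1/d}\alpha^{ -2}|W_2|$. If $\frac{|W_2|^d}{|W_2|(|W_2|-1)\cdots(|W_2|-d+1)} \le 1 + \varepsilon$, then $G$ contains a copy of $H$.
   Context: For a bipartite graph with parts $V_1, V_2$, density means $\frac{e(V_1,V_2)}{|V_1||V_2|}$, where $e(V_1,V_2)$ is the number of edges. "Contains a copy of $H$" means has a (not necessarily induced) subgraph isomorphic to $H$.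
   Formalization: The positive real numbers ε and α are taken to be rational; the conditions with α^{ -d}, α^{ -2}, the d-th root and the ratio are stated with denominators and roots cleared. -}

module Defs where

open import Data.Nat using (ℕ; zero; suc; _∸_) renaming (_*_ to _*ℕ_)
open import Data.Fin using (Fin)
open import Data.Bool using (Bool; true; false; T; if_then_else_)
open import Data.List using (List; map)
open import Data.Nat.ListAction using (sum)
open import Data.List.Base using (allFin)
open import Data.Sum using (_⊎_; inj₁; inj₂)
open import Data.Product using (Σ; _×_)
open import Data.Empty using (⊥)
open import Data.Integer using (+_)
open import Data.Rational using (ℚ; _/_; _*_; 1ℚ)
open import Function.Definitions using (Injective)
open import Relation.Binary.PropositionalEquality using (_≡_)

toℚ : ℕ → ℚ
toℚ n = + n / 1

_^ℚ_ : ℚ → ℕ → ℚ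
x ^ℚ zero = 1ℚ
x ^ℚ suc k = x * (x ^ℚ k)

falling : ℕ → ℕ → ℕ
falling m zero = 1
falling m (suc d) = (m ∸ d) *ℕ falling m d

record BipGraph : Set where
  field
    n₁  : ℕ
    n₂  : ℕ
    adj : Fin n₁ → Fin n₂ → Bool
open BipGraph public

Vert : BipGraph → Set
Vert G = Fin (n₁ G) ⊎ Fin (n₂ G)

Adj : (G : BipGraph) → Vert G → Vert G → Set
Adj G (inj₁ i) (inj₂ j) = T (adj G i j)
Adj G (inj₂ j) (inj₁ i) = T (adj G i j)
Adj G (inj₁ _) (inj₁ _) = ⊥
Adj G (inj₂ _) (inj₂ _) = ⊥

deg₁ : (G : BipGraph) → Fin (n₁ G) → ℕ
deg₁ G i = sum (map (λ j → if adj G i j then 1 else 0) (allFin (n₂ G)))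

edges : BipGraph → ℕ
edges G = sum (map (deg₁ G) (allFin (n₁ G)))

ContainsCopy : (G H : BipGraph) → Set
ContainsCopy G H =
  Σ (Vert H → Vert G) λ f →
    Injective _≡_ _≡_ f × (∀ u v → Adj H u v → Adj G (f u) (f v))

{-# OPTIONS --safe #-}

-- Dependent random choice with one base vertex.  Fix v in V₁ and place W₂ injectively and uniformly at
-- random into N(v).  A vertex i of W₁ must then go to the common neighbourhood S_i of the images of its
-- (at most d) neighbours.  If ∑ 1/∣S_i∣ ≤ 1, choosing greedily from the smallest set upwards gives
-- distinct representatives.  Since ∑_v ∑_{T ⊆ N(v)} 1/∣N(T)∣ counts each d-tuple T of V₂ at most once,
-- a suitable v with ∣N(v)∣ ≥ ∣W₂∣ exists as soon as, writing (x)_d = x(x-1)⋯(x-d+1),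
--   ∑_{deg v ≥ ∣W₂∣} (deg v)_d  ≥  ∣W₁∣ (∣V₂∣)_d.
-- Convexity of (x)_d bounds the left-hand side below by ∣V₁∣ ((α∣V₂∣)_d - (∣W₂∣)_d), and it remains to show
--   α^d (m)_d + (1+ε) (x)_d  ≤  (1+ε) (αm)_d    for m = ∣V₂∣ and x = ∣W₂∣.
-- With a = αm and b = α²m this follows from (b)_d (m)_d ≤ (a)_d², the monotonicity of (x)_d / x^d and of
-- x^d - (x)_d, and (b)_d / b^d ≥ (x)_d / x^d ≥ 1/(1+ε).

module Submission where

open import Defs

module FallingFactorials where

  open import Data.Empty using (⊥-elim)
  import Data.Integer as ℤ
  import Data.Integer.Properties as ℤₚ
  open import Data.List using (List; []; _∷_; map; length)
  open import Data.Nat as ℕ using (ℕ; zero; suc; _∸_; z≤n)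
  open import Data.Nat.ListAction using (sum)
  import Data.Nat.Properties as ℕₚ
  open import Data.Product using (_×_; _,_; ∃-syntax)
  open import Data.Rational
  open import Data.Rational.Properties
  open import Data.Rational.Solver using (module +-*-Solver)
  import Data.Rational.Unnormalised as ℚᵘ
  import Data.Rational.Unnormalised.Properties as ℚᵘₚ
  open import Data.Sum using (inj₁; inj₂)
  open import Relation.Binary.PropositionalEquality
    using (_≡_; refl; sym; trans; cong; cong₂; subst; subst₂; module ≡-Reasoning)
  open import Relation.Nullary using (yes; no)
  open +-*-Solver

  -- Order lemmas for rational arithmetic.

  0≤q-p : ∀ {p q} → p ≤ q → 0ℚ ≤ q - p
  0≤q-p {p} {q} p≤q = subst (_≤ q - p) (+-inverseʳ p) (+-monoˡ-≤ (- p) p≤q)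

  0<q-p : ∀ {p q} → p < q → 0ℚ < q - p
  0<q-p {p} {q} p<q = subst (_< q - p) (+-inverseʳ p) (+-monoˡ-< (- p) p<q)

  -- The pattern for polynomial inequalities below: the difference is written as a visibly
  -- nonnegative `r`, and the ring solver checks the identity.
  ≤-from-gap : ∀ {p q} r → 0ℚ ≤ r → q ≡ p + r → p ≤ q
  ≤-from-gap {p} r 0≤r refl = subst (_≤ p + r) (+-identityʳ p) (+-monoʳ-≤ p 0≤r)

  0≤+ : ∀ {p q} → 0ℚ ≤ p → 0ℚ ≤ q → 0ℚ ≤ p + q
  0≤+ = +-mono-≤

  *-monoˡ-≤-0≤ : ∀ {p q} r → 0ℚ ≤ r → p ≤ q → r * p ≤ r * q
  *-monoˡ-≤-0≤ r 0≤r = *-monoˡ-≤-nonNeg r {{nonNegative 0≤r}}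

  0≤* : ∀ {p q} → 0ℚ ≤ p → 0ℚ ≤ q → 0ℚ ≤ p * q
  0≤* {p} {q} 0≤p 0≤q = subst (_≤ p * q) (*-zeroʳ p) (*-monoˡ-≤-0≤ p 0≤p 0≤q)

  0<* : ∀ {p q} → 0ℚ < p → 0ℚ < q → 0ℚ < p * q
  0<* {p} {q} 0<p 0<q =
    subst (_< p * q) (*-zeroʳ p) (*-monoʳ-<-pos p {{positive 0<p}} 0<q)

  *-mono-≤-0≤ : ∀ {p q r s} → 0ℚ ≤ q → 0ℚ ≤ r → p ≤ q → r ≤ s → p * r ≤ q * s
  *-mono-≤-0≤ {p} {q} {r} {s} 0≤q 0≤r p≤q r≤s =
    ≤-trans (*-monoʳ-≤-nonNeg r {{nonNegative 0≤r}} p≤q) (*-monoˡ-≤-0≤ q 0≤q r≤s)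

  shrink-≤ : ∀ {α y} → α ≤ 1ℚ → 0ℚ ≤ y → α * y ≤ y
  shrink-≤ {α} {y} α≤1 0≤y = subst (α * y ≤_) (*-identityˡ y) (*-monoʳ-≤-nonNeg y {{nonNegative 0≤y}} α≤1)

  *-cancelˡ-≤-0< : ∀ {p q} r → 0ℚ < r → r * p ≤ r * q → p ≤ q
  *-cancelˡ-≤-0< r 0<r = *-cancelˡ-≤-pos r {{positive 0<r}}

  0≤square : ∀ p → 0ℚ ≤ p * p
  0≤square p with ≤-total 0ℚ p
  ... | inj₁ 0≤p = 0≤* 0≤p 0≤p
  ... | inj₂ p≤0 = subst (0ℚ ≤_) (solve 1 (λ p → (:- p) :* (:- p) := p :* p) refl p) (0≤* 0≤-p 0≤-p)
    where
    0≤-p : 0ℚ ≤ - p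
    0≤-p = neg-antimono-≤ p≤0

  -- The embedding of ℕ into ℚ.

  toℚᵘ-toℚ : ∀ n → toℚᵘ (toℚ n) ℚᵘ.≃ ℚᵘ.mkℚᵘ (ℤ.+ n) 0
  toℚᵘ-toℚ n = toℚᵘ-fromℚᵘ (ℚᵘ.mkℚᵘ (ℤ.+ n) 0)

  toℚ-+ : ∀ m n → toℚ (m ℕ.+ n) ≡ toℚ m + toℚ n
  toℚ-+ m n = toℚᵘ-injective (ℚᵘₚ.≃-trans (toℚᵘ-toℚ (m ℕ.+ n))
    (ℚᵘₚ.≃-trans (ℚᵘ.*≡* eq) (ℚᵘₚ.≃-sym (ℚᵘₚ.≃-trans (toℚᵘ-homo-+ (toℚ m) (toℚ n))
      (ℚᵘₚ.+-cong (toℚᵘ-toℚ m) (toℚᵘ-toℚ n))))))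
    where
    eq : ℤ.+ (m ℕ.+ n) ℤ.* ℤ.+ 1 ≡ (ℤ.+ m ℤ.* ℤ.+ 1 ℤ.+ ℤ.+ n ℤ.* ℤ.+ 1) ℤ.* ℤ.+ 1
    eq = cong (ℤ._* ℤ.+ 1) (trans (ℤₚ.pos-+ m n) (sym (cong₂ ℤ._+_ (ℤₚ.*-identityʳ (ℤ.+ m)) (ℤₚ.*-identityʳ (ℤ.+ n)))))

  toℚ-* : ∀ m n → toℚ (m ℕ.* n) ≡ toℚ m * toℚ n
  toℚ-* m n = toℚᵘ-injective (ℚᵘₚ.≃-trans (toℚᵘ-toℚ (m ℕ.* n))
    (ℚᵘₚ.≃-trans (ℚᵘ.*≡* (cong (ℤ._* ℤ.+ 1) (ℤₚ.pos-* m n))) (ℚᵘₚ.≃-sym (ℚᵘₚ.≃-trans (toℚᵘ-homo-* (toℚ m) (toℚ n))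
      (ℚᵘₚ.*-cong (toℚᵘ-toℚ m) (toℚᵘ-toℚ n))))))

  toℚ-mono-≤ : ∀ {m n} → m ℕ.≤ n → toℚ m ≤ toℚ n
  toℚ-mono-≤ {m} {n} m≤n = toℚᵘ-cancel-≤ (ℚᵘₚ.≤-trans (ℚᵘₚ.≤-reflexive (toℚᵘ-toℚ m))
    (ℚᵘₚ.≤-trans (ℚᵘ.*≤* (ℤₚ.*-monoʳ-≤-nonNeg (ℤ.+ 1) (ℤ.+≤+ m≤n))) (ℚᵘₚ.≤-reflexive (ℚᵘₚ.≃-sym (toℚᵘ-toℚ n)))))

  toℚ-cancel-≤ : ∀ {m n} → toℚ m ≤ toℚ n → m ℕ.≤ n
  toℚ-cancel-≤ {m} {n} m≤n with
    ℚᵘₚ.≤-trans (ℚᵘₚ.≤-reflexive (ℚᵘₚ.≃-sym (toℚᵘ-toℚ m))) (ℚᵘₚ.≤-trans (toℚᵘ-mono-≤ m≤n) (ℚᵘₚ.≤-reflexive (toℚᵘ-toℚ n)))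
  ... | ℚᵘ.*≤* m*1≤n*1 = ℤₚ.drop‿+≤+ (ℤₚ.*-cancelʳ-≤-pos (ℤ.+ m) (ℤ.+ n) (ℤ.+ 1) m*1≤n*1)

  toℚ-suc : ∀ n → toℚ (suc n) ≡ 1ℚ + toℚ n
  toℚ-suc n = toℚ-+ 1 n

  0≤toℚ : ∀ n → 0ℚ ≤ toℚ n
  0≤toℚ n = toℚ-mono-≤ {0} {n} z≤n

  0<toℚ : ∀ {n} → 0 ℕ.< n → 0ℚ < toℚ n
  0<toℚ {n} 0<n with toℚ n ≤? 0ℚ
  ... | yes n≤0 = ⊥-elim (ℕₚ.<⇒≱ 0<n (toℚ-cancel-≤ {n} {0} n≤0))
  ... | no n≰0 = ≰⇒> n≰0

  toℚ-∸ : ∀ {m n} → n ℕ.≤ m → toℚ (m ∸ n) ≡ toℚ m - toℚ n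
  toℚ-∸ {m} {n} n≤m = begin
    toℚ (m ∸ n)                      ≡⟨ solve 2 (λ x y → x := x :+ y :- y) refl (toℚ (m ∸ n)) (toℚ n) ⟩
    toℚ (m ∸ n) + toℚ n - toℚ n      ≡⟨ cong (_- toℚ n) (toℚ-+ (m ∸ n) n) ⟨
    toℚ (m ∸ n ℕ.+ n) - toℚ n        ≡⟨ cong (λ k → toℚ k - toℚ n) (ℕₚ.m∸n+n≡m n≤m) ⟩
    toℚ m - toℚ n                    ∎
    where open ≡-Reasoning

  -- Powers with natural exponents.

  ^ℚ-pos : ∀ {x} d → 0ℚ < x → 0ℚ < x ^ℚ d
  ^ℚ-pos zero    0<x = positive⁻¹ 1ℚ
  ^ℚ-pos (suc d) 0<x = 0<* 0<x (^ℚ-pos d 0<x)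

  ^ℚ-nonneg : ∀ {x} d → 0ℚ ≤ x → 0ℚ ≤ x ^ℚ d
  ^ℚ-nonneg zero    0≤x = nonNegative⁻¹ 1ℚ
  ^ℚ-nonneg (suc d) 0≤x = 0≤* 0≤x (^ℚ-nonneg d 0≤x)

  ^ℚ-mono-≤ : ∀ {x y} d → 0ℚ ≤ x → x ≤ y → x ^ℚ d ≤ y ^ℚ d
  ^ℚ-mono-≤ zero    0≤x x≤y = ≤-refl
  ^ℚ-mono-≤ (suc d) 0≤x x≤y =
    *-mono-≤-0≤ (≤-trans 0≤x x≤y) (^ℚ-nonneg d 0≤x) x≤y (^ℚ-mono-≤ d 0≤x x≤y)

  ^ℚ-mono-< : ∀ {x y} d → 0ℚ < x → x < y → x ^ℚ suc d < y ^ℚ suc d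
  ^ℚ-mono-< {x} {y} d 0<x x<y = <-≤-trans
    (*-monoˡ-<-pos (x ^ℚ d) {{positive (^ℚ-pos d 0<x)}} x<y)
    (*-monoˡ-≤-0≤ y (<⇒≤ (<-trans 0<x x<y)) (^ℚ-mono-≤ d (<⇒≤ 0<x) (<⇒≤ x<y)))

  ^ℚ-cancel-≤ : ∀ {x y} d → .{{ℕ.NonZero d}} → 0ℚ < y → x ^ℚ d ≤ y ^ℚ d → x ≤ y
  ^ℚ-cancel-≤ {x} {y} (suc d) 0<y xᵈ≤yᵈ with x ≤? y
  ... | yes x≤y = x≤y
  ... | no x≰y = ⊥-elim (<-irrefl refl (<-≤-trans (^ℚ-mono-< d 0<y (≰⇒> x≰y)) xᵈ≤yᵈ))

  ^ℚ-distrib-* : ∀ x y d → (x * y) ^ℚ d ≡ x ^ℚ d * y ^ℚ d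
  ^ℚ-distrib-* x y zero    = refl
  ^ℚ-distrib-* x y (suc d) = trans (cong (x * y *_) (^ℚ-distrib-* x y d))
    (solve 4 (λ x y X Y → x :* y :* (X :* Y) := x :* X :* (y :* Y)) refl x y (x ^ℚ d) (y ^ℚ d))

  ^ℚ-distrib-+ : ∀ x m n → x ^ℚ (m ℕ.+ n) ≡ x ^ℚ m * x ^ℚ n
  ^ℚ-distrib-+ x zero    n = sym (*-identityˡ (x ^ℚ n))
  ^ℚ-distrib-+ x (suc m) n = trans (cong (x *_) (^ℚ-distrib-+ x m n)) (sym (*-assoc x _ _))

  ^ℚ-double : ∀ x d → x ^ℚ (2 ℕ.* d) ≡ x ^ℚ d * x ^ℚ d
  ^ℚ-double x d = trans (cong (λ k → x ^ℚ (d ℕ.+ k)) (ℕₚ.+-identityʳ d)) (^ℚ-distrib-+ x d d)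

  -- Falling factorials as polynomials over ℚ.

  -- Not truncated: it agrees with falling only at arguments ≥ d, and positivity and monotonicity need d ≤ x.
  fallingℚ : ℕ → ℚ → ℚ
  fallingℚ zero    x = 1ℚ
  fallingℚ (suc d) x = (x - toℚ d) * fallingℚ d x

  toℚ-suc≤ : ∀ d {x} → toℚ (suc d) ≤ x → toℚ d ≤ x
  toℚ-suc≤ d = ≤-trans (toℚ-mono-≤ {d} {suc d} (ℕₚ.n≤1+n d))

  toℚ-suc< : ∀ d {x} → toℚ (suc d) ≤ x → toℚ d < x
  toℚ-suc< d d+1≤x = <-≤-trans (subst (toℚ d <_) (sym (toℚ-suc d))
    (subst (_< 1ℚ + toℚ d) (+-identityˡ (toℚ d)) (+-monoˡ-< (toℚ d) (positive⁻¹ 1ℚ)))) d+1≤x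

  fallingℚ-pos : ∀ d {x} → toℚ d ≤ x → 0ℚ < fallingℚ d x
  fallingℚ-pos zero    d≤x = positive⁻¹ 1ℚ
  fallingℚ-pos (suc d) d≤x = 0<* (0<q-p (toℚ-suc< d d≤x)) (fallingℚ-pos d (toℚ-suc≤ d d≤x))

  fallingℚ-nonneg : ∀ d {x} → toℚ d ≤ x → 0ℚ ≤ fallingℚ d x
  fallingℚ-nonneg d d≤x = <⇒≤ (fallingℚ-pos d d≤x)

  fallingℚ-mono-≤ : ∀ d {x y} → toℚ d ≤ x → x ≤ y → fallingℚ d x ≤ fallingℚ d y
  fallingℚ-mono-≤ zero    d≤x x≤y = ≤-refl
  fallingℚ-mono-≤ (suc d) {x} {y} d≤x x≤y =
    *-mono-≤-0≤ (0≤q-p (≤-trans (toℚ-suc≤ d d≤x) x≤y)) (fallingℚ-nonneg d (toℚ-suc≤ d d≤x))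
      (+-monoˡ-≤ (- toℚ d) x≤y) (fallingℚ-mono-≤ d (toℚ-suc≤ d d≤x) x≤y)

  0≤-from-toℚ≤ : ∀ d {x} → toℚ d ≤ x → 0ℚ ≤ x
  0≤-from-toℚ≤ d = ≤-trans (0≤toℚ d)

  p-q≤p : ∀ p {q} → 0ℚ ≤ q → p - q ≤ p
  p-q≤p p {q} 0≤q = ≤-from-gap q 0≤q (solve 2 (λ p q → p := p :- q :+ q) refl p q)

  fallingℚ≤^ℚ : ∀ d {x} → toℚ d ≤ x → fallingℚ d x ≤ x ^ℚ d
  fallingℚ≤^ℚ zero    d≤x = ≤-refl
  fallingℚ≤^ℚ (suc d) {x} d≤x =
    *-mono-≤-0≤ (0≤-from-toℚ≤ d d′≤x) (fallingℚ-nonneg d d′≤x) (p-q≤p x (0≤toℚ d)) (fallingℚ≤^ℚ d d′≤x)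
    where
    d′≤x = toℚ-suc≤ d d≤x

  -- Monotonicity of (x)_d / x^d with denominators cleared. It holds factor by factor, since x(y -
  -- k) - (x - k)y = k(y - x) ≥ 0.
  fallingℚ-ratio-mono : ∀ d {x y} → toℚ d ≤ x → x ≤ y → fallingℚ d x * y ^ℚ d ≤ x ^ℚ d * fallingℚ d y
  fallingℚ-ratio-mono zero    d≤x x≤y = ≤-refl
  fallingℚ-ratio-mono (suc d) {x} {y} d≤x x≤y = subst₂ _≤_
    (solve 4 (λ z G y Y → z :* y :* (G :* Y) := z :* G :* (y :* Y)) refl (x - toℚ d) (fallingℚ d x) y (y ^ℚ d))
    (solve 4 (λ x z X G → x :* z :* (X :* G) := x :* X :* (z :* G)) refl x (y - toℚ d) (x ^ℚ d) (fallingℚ d y))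
    (*-mono-≤-0≤ (0≤* 0≤x (0≤q-p (≤-trans d′≤x x≤y)))
      (0≤* (fallingℚ-nonneg d d′≤x) (^ℚ-nonneg d (≤-trans 0≤x x≤y)))
      (≤-from-gap {(x - toℚ d) * y} (toℚ d * (y - x)) (0≤* (0≤toℚ d) (0≤q-p x≤y))
        (solve 3 (λ x y k → x :* (y :- k) := (x :- k) :* y :+ k :* (y :- x)) refl x y (toℚ d)))
      (fallingℚ-ratio-mono d d′≤x x≤y))
    where
    d′≤x = toℚ-suc≤ d d≤x
    0≤x = 0≤-from-toℚ≤ d d′≤x

  -- Again factor by factor: given bm = a², the difference (a - k)² - (b - k)(m - k) equals k(b + m
  -- - 2a), which is nonnegative.
  fallingℚ-log-concave : ∀ d {b a m} → toℚ d ≤ b → b ≤ a → a ≤ m → b * m ≡ a * a → a + a ≤ b + m →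
    fallingℚ d b * fallingℚ d m ≤ fallingℚ d a * fallingℚ d a
  fallingℚ-log-concave zero    d≤b b≤a a≤m bm≡aa 2a≤b+m = ≤-refl
  fallingℚ-log-concave (suc d) {b} {a} {m} d≤b b≤a a≤m bm≡aa 2a≤b+m = subst₂ _≤_
    (interchange (b - toℚ d) (m - toℚ d) (fallingℚ d b) (fallingℚ d m))
    (interchange (a - toℚ d) (a - toℚ d) (fallingℚ d a) (fallingℚ d a))
    (*-mono-≤-0≤ (0≤square (a - toℚ d))
      (0≤* (fallingℚ-nonneg d d′≤b) (fallingℚ-nonneg d (≤-trans d′≤b (≤-trans b≤a a≤m))))
      (≤-from-gap {(b - toℚ d) * (m - toℚ d)} (toℚ d * ((b + m) - (a + a))) (0≤* (0≤toℚ d) (0≤q-p 2a≤b+m)) factor)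
      (fallingℚ-log-concave d d′≤b b≤a a≤m bm≡aa 2a≤b+m))
    where
    d′≤b = toℚ-suc≤ d d≤b
    interchange : ∀ x y z w → x * y * (z * w) ≡ x * z * (y * w)
    interchange = solve 4 (λ x y z w → x :* y :* (z :* w) := x :* z :* (y :* w)) refl
    open ≡-Reasoning
    factor : (a - toℚ d) * (a - toℚ d) ≡ (b - toℚ d) * (m - toℚ d) + toℚ d * ((b + m) - (a + a))
    factor = begin
      (a - toℚ d) * (a - toℚ d)
        ≡⟨ solve 2 (λ a k → (a :- k) :* (a :- k) := a :* a :- (a :+ a) :* k :+ k :* k) refl a (toℚ d) ⟩
      a * a - (a + a) * toℚ d + toℚ d * toℚ d
        ≡⟨ cong (λ z → z - (a + a) * toℚ d + toℚ d * toℚ d) bm≡aa ⟨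
      b * m - (a + a) * toℚ d + toℚ d * toℚ d
        ≡⟨ solve 4 (λ b m c k → b :* m :- c :* k :+ k :* k := (b :- k) :* (m :- k) :+ k :* ((b :+ m) :- c))
             refl b m (a + a) (toℚ d) ⟩
      (b - toℚ d) * (m - toℚ d) + toℚ d * ((b + m) - (a + a)) ∎

  -- The recursion x^(d+1) - (x)_(d+1) = x(x^d - (x)_d) + d (x)_d has summands that are each
  -- monotone.
  ^ℚ-fallingℚ-mono : ∀ d {x y} → toℚ d ≤ x → x ≤ y → x ^ℚ d - fallingℚ d x ≤ y ^ℚ d - fallingℚ d y
  ^ℚ-fallingℚ-mono zero    d≤x x≤y = ≤-refl
  ^ℚ-fallingℚ-mono (suc d) {x} {y} d≤x x≤y = subst₂ _≤_
    (split x (x ^ℚ d) (fallingℚ d x)) (split y (y ^ℚ d) (fallingℚ d y))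
    (+-mono-≤
      (*-mono-≤-0≤ (≤-trans 0≤x x≤y) (0≤q-p (fallingℚ≤^ℚ d d′≤x)) x≤y (^ℚ-fallingℚ-mono d d′≤x x≤y))
      (*-monoˡ-≤-0≤ (toℚ d) (0≤toℚ d) (fallingℚ-mono-≤ d d′≤x x≤y)))
    where
    d′≤x = toℚ-suc≤ d d≤x
    0≤x = 0≤-from-toℚ≤ d d′≤x
    split : ∀ x X g → x * (X - g) + toℚ d * g ≡ x * X - (x - toℚ d) * g
    split x X g = solve 4 (λ k x X g → x :* (X :- g) :+ k :* g := x :* X :- (x :- k) :* g) refl (toℚ d) x X g

  -- Truncated falling factorials: comparison with the polynomials, and convexity.

  falling≡fallingℚ : ∀ d {n} → d ℕ.≤ n → toℚ (falling n d) ≡ fallingℚ d (toℚ n)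
  falling≡fallingℚ zero    d≤n = refl
  falling≡fallingℚ (suc d) {n} d<n = trans (toℚ-* (n ∸ d) (falling n d))
    (cong₂ _*_ (toℚ-∸ (ℕₚ.<⇒≤ d<n)) (falling≡fallingℚ d (ℕₚ.<⇒≤ d<n)))

  -- Convexity as a supporting line at `a`. The bound for d + 1 is the bound for d times the factor
  -- n - d, up to the nonnegative error s(n - a)². The truncated `falling` is used because degrees
  -- may lie below d, where the polynomial oscillates.
  falling-tangent : ∀ d {a} → toℚ d ≤ a →
    ∃[ s ] 0ℚ ≤ s × (∀ n → fallingℚ d a + s * (toℚ n - a) ≤ toℚ (falling n d))
  falling-tangent zero {a} d≤a = 0ℚ , ≤-refl , λ n → ≤-reflexive
    (trans (cong (1ℚ +_) (*-zeroˡ (toℚ n - a))) (+-identityʳ 1ℚ))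
  falling-tangent (suc d) {a} d≤a with falling-tangent d (toℚ-suc≤ d d≤a)
  ... | s , 0≤s , below = s′ , 0≤s′ , below′
    where
    d′≤a = toℚ-suc≤ d d≤a
    g = fallingℚ d a
    k = toℚ d
    -- The product rule for the derivative of (a - k) g.
    s′ = g + s * (a - k)
    0≤s′ : 0ℚ ≤ s′
    0≤s′ = 0≤+ (fallingℚ-nonneg d d′≤a) (0≤* 0≤s (0≤q-p d′≤a))
    below′ : ∀ n → (a - k) * g + s′ * (toℚ n - a) ≤ toℚ ((n ∸ d) ℕ.* falling n d)
    below′ n with d ℕ.≤? n
    ... | yes d≤n = subst ((a - k) * g + s′ * (toℚ n - a) ≤_)
            (sym (trans (toℚ-* (n ∸ d) (falling n d)) (cong (_* toℚ (falling n d)) (toℚ-∸ d≤n))))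
            (≤-trans
              (≤-from-gap (s * ((toℚ n - a) * (toℚ n - a))) (0≤* 0≤s (0≤square (toℚ n - a)))
                (solve 5 (λ g a k s n → (n :- k) :* (g :+ s :* (n :- a)) :=
                   ((a :- k) :* g :+ (g :+ s :* (a :- k)) :* (n :- a)) :+ s :* ((n :- a) :* (n :- a)))
                   refl g a k s (toℚ n)))
              (*-monoˡ-≤-0≤ (toℚ n - k) (0≤q-p (toℚ-mono-≤ {d} {n} d≤n)) (below n)))
    -- To the left of d the supporting line is nonpositive, and a value of `falling` is at least 0.
    ... | no d≰n = ≤-trans
            (≤-from-gap (g * (k - toℚ n) + s * ((a - k) * (a - toℚ n)))
              (0≤+ (0≤* (fallingℚ-nonneg d d′≤a) (0≤q-p n≤d))
                (0≤* 0≤s (0≤* (0≤q-p d′≤a) (0≤q-p (≤-trans n≤d d′≤a)))))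
              (solve 5 (λ g a k s n → con 0ℚ :=
                 ((a :- k) :* g :+ (g :+ s :* (a :- k)) :* (n :- a)) :+ (g :* (k :- n) :+ s :* ((a :- k) :* (a :- n))))
                 refl g a k s (toℚ n)))
            (0≤toℚ ((n ∸ d) ℕ.* falling n d))
      where
      n≤d : toℚ n ≤ k
      n≤d = toℚ-mono-≤ {n} {d} (ℕₚ.<⇒≤ (ℕₚ.≰⇒> d≰n))

  -- The inequality relating the falling factorials of m, αm and x.

  -- With p, q the d-th powers of b′ = α²m and a′ = αm, and b, a their falling factorials: multiplying the
  -- claim by b and using p ≤ (1+ε)b and bm ≤ a² reduces it to b(p - b) ≤ θ a(q - a).
  quadratic-certificate : ∀ {ε θ b p q a m g} → 0ℚ < b → 0ℚ ≤ θ → p ≡ θ * q → b ≤ p → b ≤ a → a ≤ q →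
    (1ℚ + ε) * g ≤ ε * b → p ≤ (1ℚ + ε) * b → b * m ≤ a * a → p - b ≤ q - a → b ≤ θ * a →
    θ * m + (1ℚ + ε) * g ≤ (1ℚ + ε) * a
  quadratic-certificate {ε} {θ} {b} {_} {q} {a} {m} {g} 0<b 0≤θ refl b≤p b≤a a≤q eg≤εb p≤eb bm≤aa gap b≤θa =
    *-cancelˡ-≤-0< b 0<b (≤-from-gap slack 0≤slack
      (solve 7 (λ ε θ b q a m g →
         b :* ((con 1ℚ :+ ε) :* a) :=
         b :* (θ :* m :+ (con 1ℚ :+ ε) :* g)
         :+ (((con 1ℚ :+ ε) :* b :- θ :* q) :* (a :- b)
         :+ (θ :* a :* ((q :- a) :- (θ :* q :- b))
         :+ ((θ :* a :- b) :* (θ :* q :- b)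
         :+ (θ :* (a :* a :- b :* m)
         :+ b :* (ε :* b :- (con 1ℚ :+ ε) :* g))))))
         refl ε θ b q a m g))
    where
    0≤b = <⇒≤ 0<b
    slack = ((1ℚ + ε) * b - θ * q) * (a - b)
          + (θ * a * ((q - a) - (θ * q - b))
          + ((θ * a - b) * (θ * q - b)
          + (θ * (a * a - b * m)
          + b * (ε * b - (1ℚ + ε) * g))))
    0≤slack : 0ℚ ≤ slack
    0≤slack = 0≤+ (0≤* (0≤q-p p≤eb) (0≤q-p b≤a))
      (0≤+ (0≤* (0≤* 0≤θ (≤-trans 0≤b b≤a)) (0≤q-p gap))
      (0≤+ (0≤* (0≤q-p b≤θa) (0≤q-p b≤p))
      (0≤+ (0≤* 0≤θ (0≤q-p bm≤aa))
      (0≤* 0≤b (0≤q-p eg≤εb)))))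

  falling-inequality : ∀ d {ε α x m} → 0ℚ ≤ ε → 0ℚ < α → α ≤ 1ℚ → 0ℚ < x →
    toℚ d ≤ x → x ≤ α * (α * m) →
    (1ℚ + ε) * x ^ℚ d ≤ ε * (α * (α * m)) ^ℚ d →
    x ^ℚ d ≤ (1ℚ + ε) * fallingℚ d x →
    α ^ℚ d * fallingℚ d m + (1ℚ + ε) * fallingℚ d x ≤ (1ℚ + ε) * fallingℚ d (α * m)
  falling-inequality d {ε} {α} {x} {m} 0≤ε 0<α α≤1 0<x d≤x x≤b ex≤εb x≤eg =
    quadratic-certificate {ε} {α ^ℚ d} {fallingℚ d b} {b ^ℚ d} {a ^ℚ d} {fallingℚ d a} {fallingℚ d m} {fallingℚ d x}
      (fallingℚ-pos d d≤b) (^ℚ-nonneg d 0≤α) (^ℚ-distrib-* α a d)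
      (fallingℚ≤^ℚ d d≤b) (fallingℚ-mono-≤ d d≤b b≤a) (fallingℚ≤^ℚ d d≤a)
      eg≤εb p≤eb
      (fallingℚ-log-concave d d≤b b≤a a≤m
        (solve 2 (λ α m → α :* (α :* m) :* m := α :* m :* (α :* m)) refl α m)
        -- AM-GM for α²m and m, whose geometric mean is αm.
        (≤-from-gap (m * ((1ℚ - α) * (1ℚ - α))) (0≤* 0≤m (0≤square (1ℚ - α)))
          (solve 2 (λ α m → α :* (α :* m) :+ m := α :* m :+ α :* m :+ m :* ((con 1ℚ :- α) :* (con 1ℚ :- α))) refl α m)))
      (^ℚ-fallingℚ-mono d d≤b b≤a)
      -- Ratio monotonicity between b and a, where b^d / a^d is α^d.
      (*-cancelˡ-≤-0< (a ^ℚ d) (^ℚ-pos d 0<a)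
        (subst₂ _≤_ (*-comm (fallingℚ d b) (a ^ℚ d))
          (trans (cong (_* fallingℚ d a) (^ℚ-distrib-* α a d))
            (solve 3 (λ t q g → t :* q :* g := q :* (t :* g)) refl (α ^ℚ d) (a ^ℚ d) (fallingℚ d a)))
          (fallingℚ-ratio-mono d d≤b b≤a)))
    where
    a = α * m
    b = α * a
    0≤α = <⇒≤ 0<α
    0<b = <-≤-trans 0<x x≤b
    d≤b = ≤-trans d≤x x≤b
    -- The signs of αm and m are both derived from α²m ≥ x > 0.
    0<a : 0ℚ < a
    0<a = *-cancelˡ-<-nonNeg α {{nonNegative 0≤α}} (subst (_< b) (sym (*-zeroʳ α)) 0<b)
    0≤m : 0ℚ ≤ m
    0≤m = *-cancelˡ-≤-0< α 0<α (subst (_≤ a) (sym (*-zeroʳ α)) (<⇒≤ 0<a))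
    b≤a = shrink-≤ α≤1 (<⇒≤ 0<a)
    a≤m = shrink-≤ α≤1 0≤m
    d≤a = ≤-trans d≤b b≤a
    e = 1ℚ + ε
    0≤e : 0ℚ ≤ e
    0≤e = 0≤+ (nonNegative⁻¹ 1ℚ) 0≤ε
    -- Ratio monotonicity between x and b transfers the hypothesis from powers to falling
    -- factorials; `p≤eb` uses the same comparison to carry the ratio bound from x to b.
    eg≤εb : e * fallingℚ d x ≤ ε * fallingℚ d b
    eg≤εb = *-cancelˡ-≤-0< (b ^ℚ d) (^ℚ-pos d 0<b) (begin
      b ^ℚ d * (e * fallingℚ d x)
        ≡⟨ solve 3 (λ p e g → p :* (e :* g) := e :* (g :* p)) refl (b ^ℚ d) e (fallingℚ d x) ⟩
      e * (fallingℚ d x * b ^ℚ d)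
        ≤⟨ *-monoˡ-≤-0≤ e 0≤e (fallingℚ-ratio-mono d d≤x x≤b) ⟩
      e * (x ^ℚ d * fallingℚ d b)
        ≡⟨ *-assoc e _ _ ⟨
      e * x ^ℚ d * fallingℚ d b
        ≤⟨ *-monoʳ-≤-nonNeg (fallingℚ d b) {{nonNegative (fallingℚ-nonneg d d≤b)}} ex≤εb ⟩
      ε * b ^ℚ d * fallingℚ d b
        ≡⟨ solve 3 (λ ε p g → ε :* p :* g := p :* (ε :* g)) refl ε (b ^ℚ d) (fallingℚ d b) ⟩
      b ^ℚ d * (ε * fallingℚ d b) ∎)
      where open ≤-Reasoning
    p≤eb : b ^ℚ d ≤ e * fallingℚ d b
    p≤eb = *-cancelˡ-≤-0< (x ^ℚ d) (^ℚ-pos d 0<x) (begin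
      x ^ℚ d * b ^ℚ d
        ≤⟨ *-monoʳ-≤-nonNeg (b ^ℚ d) {{nonNegative (^ℚ-nonneg d (<⇒≤ 0<b))}} x≤eg ⟩
      e * fallingℚ d x * b ^ℚ d
        ≡⟨ *-assoc e _ _ ⟩
      e * (fallingℚ d x * b ^ℚ d)
        ≤⟨ *-monoˡ-≤-0≤ e 0≤e (fallingℚ-ratio-mono d d≤x x≤b) ⟩
      e * (x ^ℚ d * fallingℚ d b)
        ≡⟨ solve 3 (λ e x g → e :* (x :* g) := x :* (e :* g)) refl e (x ^ℚ d) (fallingℚ d b) ⟩
      x ^ℚ d * (e * fallingℚ d b) ∎)
      where open ≤-Reasoning

  -- The summation step of Jensen's inequality: under an affine lower bound, only the total of `f`
  -- matters.
  sum-mono-linear : ∀ {ℓ} {A : Set ℓ} (c s : ℚ) (f h : A → ℕ) →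
    (∀ v → c + s * toℚ (f v) ≤ toℚ (h v)) →
    ∀ vs → toℚ (length vs) * c + s * toℚ (sum (map f vs)) ≤ toℚ (sum (map h vs))
  sum-mono-linear c s f h bound [] = ≤-reflexive
    (solve 2 (λ c s → con 0ℚ :* c :+ s :* con 0ℚ := con 0ℚ) refl c s)
  sum-mono-linear c s f h bound (v ∷ vs) = begin
    toℚ (suc (length vs)) * c + s * toℚ (f v ℕ.+ sum (map f vs))
      ≡⟨ cong₂ (λ y z → y * c + s * z) (toℚ-suc (length vs)) (toℚ-+ (f v) (sum (map f vs))) ⟩
    (1ℚ + toℚ (length vs)) * c + s * (toℚ (f v) + toℚ (sum (map f vs)))
      ≡⟨ solve 5 (λ l c s x y → (con 1ℚ :+ l) :* c :+ s :* (x :+ y) := (c :+ s :* x) :+ (l :* c :+ s :* y))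
           refl (toℚ (length vs)) c s (toℚ (f v)) (toℚ (sum (map f vs))) ⟩
    (c + s * toℚ (f v)) + (toℚ (length vs) * c + s * toℚ (sum (map f vs)))
      ≤⟨ +-mono-≤ (bound v) (sum-mono-linear c s f h bound vs) ⟩
    toℚ (h v) + toℚ (sum (map h vs))
      ≡⟨ toℚ-+ (h v) (sum (map h vs)) ⟨
    toℚ (h v ℕ.+ sum (map h vs)) ∎
    where open ≤-Reasoning

module Counting where

  open import Data.Bool using (Bool; true; false; T; if_then_else_; _∧_)
  open import Data.Bool.ListAction using (all)
  open import Data.Bool.Properties using (T-∧)
  open import Data.Empty using (⊥-elim)
  open import Data.Fin as Fin using (Fin; zero; suc)
  open import Data.List as List using (List; []; _∷_; map; length; filterᵇ; filter; _++_; allFin)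
  open import Data.List.Membership.Propositional using (_∈_; _∉_; find; lose)
  open import Data.List.Membership.Propositional.Properties
    using (∈-∃++; ∈-++⁻; ∈-++⁺ˡ; ∈-++⁺ʳ; ∈-map⁺; ∈-allFin; ∈-filter⁺; ∈-filter⁻)
  open import Data.List.Properties using (length-++; length-map; length-tabulate; length-filter; map-tabulate)
  open import Data.List.Relation.Binary.Permutation.Propositional
    using (_↭_; ↭-refl; ↭-trans; ↭-sym; prep; swap; ↭⇒↭ₛ)
  open import Data.List.Relation.Binary.Permutation.Propositional.Properties using (↭-length; map⁺; ∈-resp-↭)
  import Data.List.Relation.Binary.Permutation.Setoid.Properties as ↭ₛ
  open import Data.List.Relation.Unary.All as All using ([]; _∷_)
  open import Data.List.Relation.Unary.AllPairs using ([]; _∷_)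
  open import Data.List.Relation.Unary.Any as Any using (here; there)
  open import Data.List.Relation.Unary.Unique.Propositional using (Unique)
  import Data.List.Relation.Unary.Unique.Propositional.Properties as Unique
  open import Data.Nat
  open import Data.Nat.DivMod using (m/n*n≤m; m*[n/m]≡n; /-monoʳ-≤)
  open import Data.Nat.Divisibility using (m≤n⇒m!∣n!; ∣-trans; m∣m*n)
  open import Data.Nat.ListAction using (sum)
  open import Data.Nat.ListAction.Properties using (sum-↭)
  open import Data.Nat.Properties
  open import Data.Nat.Solver using (module +-*-Solver)
  open import Data.Product using (Σ; _×_; _,_; proj₁; proj₂; ∃-syntax)
  open import Data.Sum using (inj₁; inj₂)
  open import Data.Sum.Properties using (inj₁-injective; inj₂-injective)
  open import Data.Vec using (Vec; []; _∷_; lookup; toList; tabulate)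
  open import Data.Vec.Membership.Propositional.Properties using (∈-lookup; ∈-toList⁺)
  open import Data.Vec.Properties using (lookup∘tabulate)
  open import Function using (_∘_; id; Equivalence)
  open import Function.Definitions using (Injective)
  open import Relation.Binary using (DecidableEquality)
  open import Relation.Binary.PropositionalEquality
  open import Relation.Nullary using (¬_; Dec; yes; no)
  open import Relation.Nullary.Decidable using (T?; ¬?)

  private
    variable
      A B : Set

  -- Finite sums over lists.

  ∑ : (A → ℕ) → List A → ℕ
  ∑ f xs = sum (map f xs)

  interchange : ∀ m n o p → (m + n) + (o + p) ≡ (m + o) + (n + p)
  interchange = solve 4 (λ m n o p → (m :+ n) :+ (o :+ p) := (m :+ o) :+ (n :+ p)) refl
    where open +-*-Solver

  ∑-cong : ∀ {f g : A → ℕ} → (∀ x → f x ≡ g x) → ∀ xs → ∑ f xs ≡ ∑ g xs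
  ∑-cong f≡g []       = refl
  ∑-cong f≡g (x ∷ xs) = cong₂ _+_ (f≡g x) (∑-cong f≡g xs)

  ∑-mono-≤ : ∀ {f g : A → ℕ} → (∀ x → f x ≤ g x) → ∀ xs → ∑ f xs ≤ ∑ g xs
  ∑-mono-≤ f≤g []       = z≤n
  ∑-mono-≤ f≤g (x ∷ xs) = +-mono-≤ (f≤g x) (∑-mono-≤ f≤g xs)

  ∑-const : ∀ c (xs : List A) → ∑ (λ _ → c) xs ≡ length xs * c
  ∑-const c []       = refl
  ∑-const c (x ∷ xs) = cong (c +_) (∑-const c xs)

  ∑-*ˡ : ∀ c (f : A → ℕ) xs → ∑ (λ x → c * f x) xs ≡ c * ∑ f xs
  ∑-*ˡ c f []       = sym (*-zeroʳ c)
  ∑-*ˡ c f (x ∷ xs) = trans (cong (c * f x +_) (∑-*ˡ c f xs)) (sym (*-distribˡ-+ c (f x) (∑ f xs)))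

  ∑-filterᵇ : ∀ (p : A → Bool) c xs → ∑ (λ x → if p x then c else 0) xs ≡ length (filterᵇ p xs) * c
  ∑-filterᵇ p c [] = refl
  ∑-filterᵇ p c (x ∷ xs) with p x
  ... | true  = cong (c +_) (∑-filterᵇ p c xs)
  ... | false = ∑-filterᵇ p c xs

  ∑-filter-≤ : ∀ {P : A → Set} (P? : ∀ x → Dec (P x)) (f : A → ℕ) xs → ∑ f (filter P? xs) ≤ ∑ f xs
  ∑-filter-≤ P? f [] = z≤n
  ∑-filter-≤ P? f (x ∷ xs) with P? x
  ... | yes _ = +-monoʳ-≤ (f x) (∑-filter-≤ P? f xs)
  ... | no  _ = ≤-trans (∑-filter-≤ P? f xs) (m≤n+m _ (f x))

  -- For discarding low-degree vertices: each rejected entry loses at most `c`, and charging `c` to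
  -- the accepted ones too does no harm.
  ∑-≤-filter : ∀ {P : A → Set} (P? : ∀ x → Dec (P x)) (f : A → ℕ) c → (∀ x → ¬ P x → f x ≤ c) →
    ∀ xs → ∑ f xs ≤ ∑ f (filter P? xs) + length xs * c
  ∑-≤-filter P? f c f≤c [] = z≤n
  ∑-≤-filter P? f c f≤c (x ∷ xs) with P? x
  ... | yes _ = begin
    f x + ∑ f xs
      ≤⟨ +-monoʳ-≤ (f x) (≤-trans (∑-≤-filter P? f c f≤c xs) (+-monoʳ-≤ (∑ f (filter P? xs)) (m≤n+m _ c))) ⟩
    f x + (∑ f (filter P? xs) + (c + length xs * c))
      ≡⟨ +-assoc (f x) _ _ ⟨
    f x + ∑ f (filter P? xs) + (c + length xs * c) ∎
    where open ≤-Reasoning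
  ... | no ¬Px = begin
    f x + ∑ f xs
      ≤⟨ +-mono-≤ (f≤c x ¬Px) (∑-≤-filter P? f c f≤c xs) ⟩
    c + (∑ f (filter P? xs) + length xs * c)
      ≡⟨ solve 3 (λ c s l → c :+ (s :+ l) := s :+ (c :+ l)) refl c (∑ f (filter P? xs)) (length xs * c) ⟩
    ∑ f (filter P? xs) + (c + length xs * c) ∎
    where
    open ≤-Reasoning
    open +-*-Solver

  -- The averaging principle: a head with f > g can be removed without spoiling the comparison of
  -- the sums.
  ∑-≤-∃ : ∀ (f g : A → ℕ) xs → 0 < length xs → ∑ f xs ≤ ∑ g xs → ∃[ x ] x ∈ xs × f x ≤ g x
  ∑-≤-∃ f g (x ∷ xs) _ ∑f≤∑g with f x ≤? g x
  ... | yes fx≤gx = x , here refl , fx≤gx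
  ∑-≤-∃ f g (x ∷ [])     _ ∑f≤∑g | no fx≰gx = ⊥-elim (fx≰gx (subst₂ _≤_ (+-identityʳ _) (+-identityʳ _) ∑f≤∑g))
  ∑-≤-∃ f g (x ∷ y ∷ xs) _ ∑f≤∑g | no fx≰gx
    with ∑-≤-∃ f g (y ∷ xs) z<s (+-cancelˡ-≤ (g x) _ _ (≤-trans (+-monoˡ-≤ _ (<⇒≤ (≰⇒> fx≰gx))) ∑f≤∑g))
  ... | z , z∈ , fz≤gz = z , there z∈ , fz≤gz

  -- Sums over selections and injective tuples.

  -- F u us is summed over the ways to take one entry u out of the list, leaving us.
  selectSum : (A → List A → ℕ) → List A → ℕ
  selectSum F []       = 0
  selectSum F (x ∷ xs) = F x xs + selectSum (λ u us → F u (x ∷ us)) xs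

  select-there : ∀ {x u : A} {xs us} → xs ↭ u ∷ us → x ∷ xs ↭ u ∷ x ∷ us
  select-there {x = x} {u} xs↭ = ↭-trans (prep x xs↭) (swap x u ↭-refl)

  selectSum-cong : ∀ {F G : A → List A → ℕ} xs → (∀ u us → xs ↭ u ∷ us → F u us ≡ G u us) →
    selectSum F xs ≡ selectSum G xs
  selectSum-cong []       F≡G = refl
  selectSum-cong (x ∷ xs) F≡G = cong₂ _+_ (F≡G x xs ↭-refl)
    (selectSum-cong xs (λ u us xs↭ → F≡G u (x ∷ us) (select-there xs↭)))

  selectSum-mono-≤ : ∀ {F G : A → List A → ℕ} xs → (∀ u us → F u us ≤ G u us) → selectSum F xs ≤ selectSum G xs
  selectSum-mono-≤ []       F≤G = z≤n
  selectSum-mono-≤ (x ∷ xs) F≤G = +-mono-≤ (F≤G x xs) (selectSum-mono-≤ xs (λ u us → F≤G u (x ∷ us)))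

  selectSum-+ : ∀ (F G : A → List A → ℕ) xs → selectSum (λ u us → F u us + G u us) xs ≡ selectSum F xs + selectSum G xs
  selectSum-+ F G []       = refl
  selectSum-+ F G (x ∷ xs) = trans
    (cong (F x xs + G x xs +_) (selectSum-+ (λ u us → F u (x ∷ us)) (λ u us → G u (x ∷ us)) xs))
    (interchange (F x xs) (G x xs) _ _)

  selectSum-*ˡ : ∀ c (F : A → List A → ℕ) xs → selectSum (λ u us → c * F u us) xs ≡ c * selectSum F xs
  selectSum-*ˡ c F []       = sym (*-zeroʳ c)
  selectSum-*ˡ c F (x ∷ xs) = trans (cong (c * F x xs +_) (selectSum-*ˡ c (λ u us → F u (x ∷ us)) xs))
    (sym (*-distribˡ-+ c (F x xs) _))

  selectSum-const : ∀ c (xs : List A) → selectSum (λ _ _ → c) xs ≡ length xs * c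
  selectSum-const c []       = refl
  selectSum-const c (x ∷ xs) = cong (c +_) (selectSum-const c xs)

  -- Ordered pairs of positions can be enumerated from either end. For a head `x`, the pairs with
  -- `x` drawn first on one side match those with `x` drawn second on the other.
  selectSum-comm : ∀ (F : A → A → List A → ℕ) xs →
    selectSum (λ u us → selectSum (λ v vs → F u v vs) us) xs ≡ selectSum (λ v vs → selectSum (λ u us → F u v us) vs) xs
  selectSum-comm F []       = refl
  selectSum-comm F (x ∷ xs) = begin
    selectSum (F x) xs + selectSum (λ u us → F u x us + selectSum (λ v vs → F u v (x ∷ vs)) us) xs
      ≡⟨ cong (selectSum (F x) xs +_) (selectSum-+ (λ u → F u x) (λ u us → selectSum (λ v vs → F u v (x ∷ vs)) us) xs) ⟩
    selectSum (F x) xs + (selectSum (λ u → F u x) xs + selectSum (λ u us → selectSum (λ v vs → F u v (x ∷ vs)) us) xs)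
      ≡⟨ solve 3 (λ m n o → m :+ (n :+ o) := n :+ (m :+ o)) refl (selectSum (F x) xs) (selectSum (λ u → F u x) xs) _ ⟩
    selectSum (λ u → F u x) xs + (selectSum (F x) xs + selectSum (λ u us → selectSum (λ v vs → F u v (x ∷ vs)) us) xs)
      ≡⟨ cong (λ z → selectSum (λ u → F u x) xs + (selectSum (F x) xs + z)) (selectSum-comm (λ u v vs → F u v (x ∷ vs)) xs) ⟩
    selectSum (λ u → F u x) xs + (selectSum (F x) xs + selectSum (λ v vs → selectSum (λ u us → F u v (x ∷ us)) vs) xs)
      ≡⟨ cong (selectSum (λ u → F u x) xs +_) (selectSum-+ (F x) (λ v vs → selectSum (λ u us → F u v (x ∷ us)) vs) xs) ⟨
    selectSum (λ u → F u x) xs + selectSum (λ v vs → F x v vs + selectSum (λ u us → F u v (x ∷ us)) vs) xs ∎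
    where
    open ≡-Reasoning
    open +-*-Solver

  selectSum-filterᵇ : ∀ (p : A → Bool) (F : A → List A → ℕ) xs →
    selectSum F (filterᵇ p xs) ≡ selectSum (λ u us → if p u then F u (filterᵇ p us) else 0) xs
  selectSum-filterᵇ p F [] = refl
  selectSum-filterᵇ p F (x ∷ xs) with p x
  ... | true  = cong (F x (filterᵇ p xs) +_) (selectSum-filterᵇ p (λ u us → F u (x ∷ us)) xs)
  ... | false = selectSum-filterᵇ p F xs

  selectSum-≤-∃ : ∀ (F G : A → List A → ℕ) xs → 0 < length xs → selectSum F xs ≤ selectSum G xs →
    ∃[ u ] ∃[ us ] xs ↭ u ∷ us × F u us ≤ G u us
  selectSum-≤-∃ F G (x ∷ xs) _ ∑F≤∑G with F x xs ≤? G x xs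
  ... | yes Fx≤Gx = x , xs , ↭-refl , Fx≤Gx
  selectSum-≤-∃ F G (x ∷ [])     _ ∑F≤∑G | no Fx≰Gx = ⊥-elim (Fx≰Gx (subst₂ _≤_ (+-identityʳ _) (+-identityʳ _) ∑F≤∑G))
  selectSum-≤-∃ F G (x ∷ y ∷ xs) _ ∑F≤∑G | no Fx≰Gx
    with selectSum-≤-∃ (λ u us → F u (x ∷ us)) (λ u us → G u (x ∷ us)) (y ∷ xs) z<s
           (+-cancelˡ-≤ (G x (y ∷ xs)) _ _ (≤-trans (+-monoˡ-≤ _ (<⇒≤ (≰⇒> Fx≰Gx))) ∑F≤∑G))
  ... | u , us , xs↭ , Fu≤Gu = u , x ∷ us , select-there xs↭ , Fu≤Gu

  -- An expectation over a random injection, left unnormalised so that it stays in ℕ; tuples run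
  -- over distinct positions of the list.
  injSum : ∀ k → (Vec A k → ℕ) → List A → ℕ
  injSum zero    φ xs = φ []
  injSum (suc k) φ xs = selectSum (λ u us → injSum k (λ S → φ (u ∷ S)) us) xs

  injSum-cong : ∀ k {φ ψ : Vec A k → ℕ} xs → (∀ S → φ S ≡ ψ S) → injSum k φ xs ≡ injSum k ψ xs
  injSum-cong zero    xs φ≡ψ = φ≡ψ []
  injSum-cong (suc k) xs φ≡ψ = selectSum-cong xs (λ u us _ → injSum-cong k us (λ S → φ≡ψ (u ∷ S)))

  injSum-mono-≤ : ∀ k {φ ψ : Vec A k → ℕ} xs → (∀ S → φ S ≤ ψ S) → injSum k φ xs ≤ injSum k ψ xs
  injSum-mono-≤ zero    xs φ≤ψ = φ≤ψ []
  injSum-mono-≤ (suc k) xs φ≤ψ = selectSum-mono-≤ xs (λ u us → injSum-mono-≤ k us (λ S → φ≤ψ (u ∷ S)))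

  injSum-+ : ∀ k (φ ψ : Vec A k → ℕ) xs → injSum k (λ S → φ S + ψ S) xs ≡ injSum k φ xs + injSum k ψ xs
  injSum-+ zero    φ ψ xs = refl
  injSum-+ (suc k) φ ψ xs = trans (selectSum-cong xs (λ u us _ → injSum-+ k (λ S → φ (u ∷ S)) (λ S → ψ (u ∷ S)) us))
    (selectSum-+ _ _ xs)

  injSum-*ˡ : ∀ c k (φ : Vec A k → ℕ) xs → injSum k (λ S → c * φ S) xs ≡ c * injSum k φ xs
  injSum-*ˡ c zero    φ xs = refl
  injSum-*ˡ c (suc k) φ xs = trans (selectSum-cong xs (λ u us _ → injSum-*ˡ c k (λ S → φ (u ∷ S)) us))
    (selectSum-*ˡ c _ xs)

  injSum-0 : ∀ k (xs : List A) → injSum k (λ _ → 0) xs ≡ 0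
  injSum-0 k xs = injSum-*ˡ 0 k (λ _ → 0) xs

  injSum-∑ : ∀ k (φ : B → Vec A k → ℕ) bs xs → injSum k (λ S → ∑ (λ b → φ b S) bs) xs ≡ ∑ (λ b → injSum k (φ b) xs) bs
  injSum-∑ k φ []       xs = injSum-0 k xs
  injSum-∑ k φ (b ∷ bs) xs = trans (injSum-+ k (φ b) (λ S → ∑ (λ b → φ b S) bs) xs)
    (cong (injSum k (φ b) xs +_) (injSum-∑ k φ bs xs))

  -- Turns a sum over tuples in N(v) into one over tuples in all of V₂ with an indicator, so that
  -- the sum over v can be moved inside.
  injSum-filterᵇ : ∀ k (p : A → Bool) (φ : Vec A k → ℕ) xs →
    injSum k φ (filterᵇ p xs) ≡ injSum k (λ S → if all p (toList S) then φ S else 0) xs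
  injSum-filterᵇ zero    p φ xs = refl
  injSum-filterᵇ (suc k) p φ xs = trans (selectSum-filterᵇ p _ xs) (selectSum-cong xs step)
    where
    step : ∀ u us → xs ↭ u ∷ us → (if p u then injSum k (λ S → φ (u ∷ S)) (filterᵇ p us) else 0) ≡
      injSum k (λ S → if p u ∧ all p (toList S) then φ (u ∷ S) else 0) us
    step u us _ with p u
    ... | true  = injSum-filterᵇ k p (λ S → φ (u ∷ S)) us
    ... | false = sym (injSum-0 k us)

  -- An injective k-tuple leaves length - k entries for the extra draw. In the induction that draw
  -- is moved past the first coordinate by `selectSum-comm`.
  injSum-drop : ∀ k (φ : Vec A k → ℕ) xs →
    selectSum (λ _ us → injSum k φ us) xs ≡ (length xs ∸ k) * injSum k φ xs
  injSum-drop zero    φ xs = selectSum-const (φ []) xs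
  injSum-drop (suc k) φ xs = begin
    selectSum (λ _ us → selectSum (λ v vs → injSum k (λ S → φ (v ∷ S)) vs) us) xs
      ≡⟨ selectSum-comm (λ _ v vs → injSum k (λ S → φ (v ∷ S)) vs) xs ⟩
    selectSum (λ v vs → selectSum (λ _ us → injSum k (λ S → φ (v ∷ S)) us) vs) xs
      ≡⟨ selectSum-cong xs (λ v vs xs↭ → trans (injSum-drop k (λ S → φ (v ∷ S)) vs)
           (cong (λ l → (l ∸ suc k) * injSum k (λ S → φ (v ∷ S)) vs) (sym (↭-length xs↭)))) ⟩
    selectSum (λ v vs → (length xs ∸ suc k) * injSum k (λ S → φ (v ∷ S)) vs) xs
      ≡⟨ selectSum-*ˡ (length xs ∸ suc k) _ xs ⟩
    (length xs ∸ suc k) * injSum (suc k) φ xs ∎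
    where open ≡-Reasoning

  injSum-1 : ∀ k (xs : List A) → injSum k (λ _ → 1) xs ≡ falling (length xs) k
  injSum-1 zero    xs = refl
  injSum-1 (suc k) xs = trans (injSum-drop k (λ _ → 1) xs) (cong ((length xs ∸ k) *_) (injSum-1 k xs))

  -- Averaging one coordinate at a time; `k ≤ length xs` keeps each list of candidates nonempty. The
  -- permutation records that the entries of `S` occupy distinct positions of `xs`.
  injSum-≤-∃ : ∀ k (φ ψ : Vec A k → ℕ) xs → k ≤ length xs → injSum k φ xs ≤ injSum k ψ xs →
    ∃[ S ] ∃[ rest ] xs ↭ toList S ++ rest × φ S ≤ ψ S
  injSum-≤-∃ zero    φ ψ xs _   φ≤ψ = [] , xs , ↭-refl , φ≤ψ
  injSum-≤-∃ (suc k) φ ψ xs k<l φ≤ψ with selectSum-≤-∃ _ _ xs (≤-trans z<s k<l) φ≤ψ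
  ... | u , us , xs↭ , φ≤ψ′
    with injSum-≤-∃ k (λ S → φ (u ∷ S)) (λ S → ψ (u ∷ S)) us (s≤s⁻¹ (subst (suc k ≤_) (↭-length xs↭) k<l)) φ≤ψ′
  ... | S , rest , us↭ , φS≤ψS = u ∷ S , rest , ↭-trans xs↭ (prep u us↭) , φS≤ψS

  -- Sub-tuples cut out by Boolean masks.

  trues : ∀ {k} → Vec Bool k → ℕ
  trues []          = 0
  trues (true  ∷ μ) = suc (trues μ)
  trues (false ∷ μ) = trues μ

  -- With μ marking neighbours of a vertex of W₁ and `S` the images of W₂, this is the tuple of
  -- images of the marked neighbours.
  restrict : ∀ {k} (μ : Vec Bool k) → Vec A k → Vec A (trues μ)
  restrict []          []      = []
  restrict (true  ∷ μ) (x ∷ S) = x ∷ restrict μ S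
  restrict (false ∷ μ) (x ∷ S) = restrict μ S

  -- All injective (trues μ)-tuples have the same number c of injective extensions, whatever is summed.
  injSum-restrict : ∀ {A : Set} {k} (μ : Vec Bool k) n →
    ∃[ c ] (∀ (φ : Vec A (trues μ) → ℕ) xs → length xs ≡ n →
      injSum k (λ S → φ (restrict μ S)) xs ≡ c * injSum (trues μ) φ xs)
  injSum-restrict [] n = 1 , λ φ xs _ → sym (*-identityˡ (φ []))
  injSum-restrict {k = suc k} (true ∷ μ) n with injSum-restrict μ (pred n)
  ... | c , eq = c , λ φ xs l≡n → trans
    (selectSum-cong xs (λ u us xs↭ → eq (λ S → φ (u ∷ S)) us (cong pred (trans (sym (↭-length xs↭)) l≡n))))
    (selectSum-*ˡ c _ xs)
  injSum-restrict {k = suc k} (false ∷ μ) n with injSum-restrict μ (pred n)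
  ... | c , eq = c * (n ∸ trues μ) , λ φ xs l≡n → begin
    selectSum (λ _ us → injSum k (λ S → φ (restrict μ S)) us) xs
      ≡⟨ selectSum-cong xs (λ u us xs↭ → eq φ us (cong pred (trans (sym (↭-length xs↭)) l≡n))) ⟩
    selectSum (λ _ us → c * injSum (trues μ) φ us) xs
      ≡⟨ selectSum-*ˡ c _ xs ⟩
    c * selectSum (λ _ us → injSum (trues μ) φ us) xs
      ≡⟨ cong (c *_) (injSum-drop (trues μ) φ xs) ⟩
    c * ((length xs ∸ trues μ) * injSum (trues μ) φ xs)
      ≡⟨ cong (λ l → c * ((l ∸ trues μ) * injSum (trues μ) φ xs)) l≡n ⟩
    c * ((n ∸ trues μ) * injSum (trues μ) φ xs)
      ≡⟨ *-assoc c _ _ ⟨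
    c * (n ∸ trues μ) * injSum (trues μ) φ xs ∎
    where open ≡-Reasoning

  -- Pads a neighbourhood of at most d vertices to exactly d, so that a single sum over d-tuples
  -- governs every vertex of W₁. Adjacency to the larger set implies adjacency to the original one.
  enlarge : ∀ {k} (μ : Vec Bool k) d → trues μ ≤ d → d ≤ k →
    ∃[ ν ] trues ν ≡ d × (∀ j → T (lookup μ j) → T (lookup ν j))
  enlarge []          zero    t≤d d≤k = [] , refl , λ ()
  enlarge (true ∷ μ)  (suc d) t≤d d≤k with enlarge μ d (s≤s⁻¹ t≤d) (s≤s⁻¹ d≤k)
  ... | ν , t≡d , μ⊆ν = true ∷ ν , cong suc t≡d , λ { zero _ → _ ; (suc j) → μ⊆ν j }
  enlarge (false ∷ μ) d       t≤d d≤k with trues μ ≟ d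
  ... | yes t≡d = false ∷ μ , t≡d , λ _ → id
  enlarge (false ∷ μ) zero    t≤d d≤k | no t≢d = ⊥-elim (t≢d (n≤0⇒n≡0 t≤d))
  enlarge (false ∷ μ) (suc d) t≤d d≤k | no t≢d with enlarge μ d (s≤s⁻¹ (≤∧≢⇒< t≤d t≢d)) (s≤s⁻¹ d≤k)
  ... | ν , t≡d , μ⊆ν = true ∷ ν , cong suc t≡d , λ { zero () ; (suc j) → μ⊆ν j }

  all-restrict : ∀ (p : A → Bool) {k} (μ : Vec Bool k) S → T (all p (toList (restrict μ S))) →
    ∀ j → T (lookup μ j) → T (p (lookup S j))
  all-restrict p (true  ∷ μ) (x ∷ S) pS zero    _   = proj₁ (Equivalence.to T-∧ pS)
  all-restrict p (true  ∷ μ) (x ∷ S) pS (suc j) μj  = all-restrict p μ S (proj₂ (Equivalence.to T-∧ pS)) j μj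
  all-restrict p (false ∷ μ) (x ∷ S) pS (suc j) μj  = all-restrict p μ S pS j μj

  -- Lists without repetition.

  Unique-⊆-length : ∀ {xs ys : List A} → Unique xs → (∀ {x} → x ∈ xs → x ∈ ys) → length xs ≤ length ys
  Unique-⊆-length {xs = []}     []            xs⊆ys = z≤n
  Unique-⊆-length {A = A} {xs = x ∷ xs} (x∉xs ∷ uniq) xs⊆ys with ∈-∃++ (xs⊆ys (here refl))
  -- Pigeonhole: one occurrence of `x` is cut out of `ys`, and the tail still fits in the rest
  -- because `x` does not recur in it.
  ... | as , bs , refl = subst (suc (length xs) ≤_) (sym length-eq) (s≤s (Unique-⊆-length uniq xs⊆))
    where
    length-eq : length (as ++ x ∷ bs) ≡ suc (length (as ++ bs))
    length-eq = trans (length-++ as) (trans (+-suc (length as) (length bs)) (cong suc (sym (length-++ as))))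
    xs⊆ : ∀ {y} → y ∈ xs → y ∈ as ++ bs
    xs⊆ {y} y∈xs with ∈-++⁻ as (xs⊆ys (there y∈xs))
    ... | inj₁ y∈as         = ∈-++⁺ˡ y∈as
    ... | inj₂ (here refl)  = ⊥-elim (All.lookup x∉xs y∈xs refl)
    ... | inj₂ (there y∈bs) = ∈-++⁺ʳ as y∈bs

  Unique-lookup-injective : ∀ {k} (S : Vec A k) → Unique (toList S) → ∀ i j → lookup S i ≡ lookup S j → i ≡ j
  Unique-lookup-injective (x ∷ S) (x∉S ∷ uniq) zero    zero    eq = refl
  Unique-lookup-injective (x ∷ S) (x∉S ∷ uniq) zero    (suc j) eq =
    ⊥-elim (All.lookup x∉S (∈-toList⁺ (∈-lookup j S)) eq)
  Unique-lookup-injective (x ∷ S) (x∉S ∷ uniq) (suc i) zero    eq =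
    ⊥-elim (All.lookup x∉S (∈-toList⁺ (∈-lookup i S)) (sym eq))
  Unique-lookup-injective (x ∷ S) (x∉S ∷ uniq) (suc i) (suc j) eq = cong suc (Unique-lookup-injective S uniq i j eq)

  select-max : ∀ (f : A → ℕ) x xs → ∃[ m ] ∃[ rest ] x ∷ xs ↭ m ∷ rest × (∀ {y} → y ∈ rest → f y ≤ f m)
  select-max f x [] = x , [] , ↭-refl , λ ()
  select-max f x (y ∷ ys) with select-max f y ys
  ... | m , rest , ys↭ , ≤max with f x ≤? f m
  ... | yes fx≤fm = m , x ∷ rest , select-there ys↭ , λ { (here refl) → fx≤fm ; (there z∈) → ≤max z∈ }
  ... | no  fx≰fm = x , y ∷ ys , ↭-refl , bound
    where
    fm≤fx = <⇒≤ (≰⇒> fx≰fm)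
    bound : ∀ {z} → z ∈ y ∷ ys → f z ≤ f x
    bound z∈ with ∈-resp-↭ ys↭ z∈
    ... | here refl = fm≤fx
    ... | there z∈′ = ≤-trans (≤max z∈′) fm≤fx

  -- Distinct representatives from a bound on a sum of reciprocals.

  -- L / s with L = n ! stands for 1 / s: it is exact for 1 ≤ s ≤ n, so reciprocals of set sizes stay in ℕ.
  share : ℕ → ℕ → ℕ
  share L zero    = 0
  share L (suc s) = L / suc s

  -- The case s = 0 covers tuples without a common neighbour, which contribute nothing to the double
  -- count.
  *-share-≤ : ∀ L s → s * share L s ≤ L
  *-share-≤ L zero    = z≤n
  *-share-≤ L (suc s) = subst (_≤ L) (*-comm (L / suc s) (suc s)) (m/n*n≤m L (suc s))

  *-share : ∀ {n s} → 0 < s → s ≤ n → s * share (n !) s ≡ n !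
  *-share {n} {suc s} _ s≤n = m*[n/m]≡n (∣-trans (m∣m*n (s !)) (m≤n⇒m!∣n! s≤n))

  share-anti : ∀ L {s t} → 0 < s → s ≤ t → share L t ≤ share L s
  share-anti L {suc s} {suc t} _ s≤t = /-monoʳ-≤ L s≤t

  fresh : DecidableEquality A → ∀ {xs ys : List A} → Unique xs → length ys < length xs → ∃[ x ] x ∈ xs × x ∉ ys
  fresh _≟′_ {xs} {ys} uniq l<l with Any.any? (λ x → ¬? (Any.any? (x ≟′_) ys)) xs
  ... | yes some = find some
  ... | no none = ⊥-elim (<⇒≱ l<l (Unique-⊆-length uniq λ {x} x∈xs → mem x∈xs))
    where
    mem : ∀ {x} → x ∈ xs → x ∈ ys
    mem {x} x∈xs with Any.any? (x ≟′_) ys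
    ... | yes x∈ys = x∈ys
    ... | no  x∉ys = ⊥-elim (none (lose x∈xs x∉ys))

  module _ {I V : Set} (_≟ᴵ_ : DecidableEquality I) (_≟ⱽ_ : DecidableEquality V)
           (n : ℕ) (S : I → List V) (S-unique : ∀ i → Unique (S i))
           (0<∣S∣ : ∀ i → 0 < length (S i)) (∣S∣≤n : ∀ i → length (S i) ≤ n) (default : V) where

    private
      cost : I → ℕ
      cost i = share (n !) (length (S i))

    InjectiveChoice : List I → Set
    InjectiveChoice is = Σ (I → V) λ h →
      (∀ {i} → i ∈ is → h i ∈ S i) × (∀ {i j} → i ∈ is → j ∈ is → h i ≡ h j → i ≡ j)

    -- The largest set S m is chosen from last.  It has the smallest share, so the number of sets times that
    -- share is at most n ! = ∣S m∣ * cost m, and S m still has an unused element.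
    injective-choice : ∀ k is → length is ≡ k → ∑ cost is ≤ n ! → InjectiveChoice is
    injective-choice k       []       _  _     = (λ _ → default) , (λ ()) , λ ()
    injective-choice (suc k) (x ∷ xs) l≡ ∑≤L with select-max (length ∘ S) x xs
    ... | m , rest , is↭ , ≤max
      with injective-choice k rest (suc-injective (trans (sym (↭-length is↭)) l≡))
             (≤-trans (m≤n+m _ (cost m)) (subst (_≤ n !) (sum-↭ (map⁺ cost is↭)) ∑≤L))
    ... | h , h∈ , h-inj = h′ , h′∈ ∘ ∈-resp-↭ is↭ , λ i∈ j∈ → h′-inj (∈-resp-↭ is↭ i∈) (∈-resp-↭ is↭ j∈)
      where
      ∑≤L′ : cost m + ∑ cost rest ≤ n !
      ∑≤L′ = subst (_≤ n !) (sum-↭ (map⁺ cost is↭)) ∑≤L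
      L≡ : length (S m) * cost m ≡ n !
      L≡ = *-share (0<∣S∣ m) (∣S∣≤n m)
      0<cost : 0 < cost m
      0<cost with cost m | L≡
      ... | zero  | eq = ⊥-elim (<⇒≢ (1≤n! n) (trans (sym (*-zeroʳ (length (S m)))) eq))
      ... | suc _ | _  = z<s
      mass : ∀ js → (∀ {j} → j ∈ js → length (S j) ≤ length (S m)) → length js * cost m ≤ ∑ cost js
      mass []       _  = z≤n
      mass (j ∷ js) j≤ = +-mono-≤ (share-anti (n !) (0<∣S∣ j) (j≤ (here refl))) (mass js (j≤ ∘ there))
      rest<∣Sm∣ : length (map h rest) < length (S m)
      rest<∣Sm∣ = subst (_< length (S m)) (sym (length-map h rest))
        (*-cancelʳ-≤ (suc (length rest)) (length (S m)) (cost m) {{>-nonZero 0<cost}}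
          (≤-trans (+-monoʳ-≤ (cost m) (mass rest ≤max)) (≤-trans ∑≤L′ (≤-reflexive (sym L≡)))))
      new : ∃[ v ] v ∈ S m × v ∉ map h rest
      new = fresh _≟ⱽ_ (S-unique m) rest<∣Sm∣
      h′ : I → V
      h′ i with i ≟ᴵ m
      ... | yes _ = proj₁ new
      ... | no  _ = h i
      h′∈ : ∀ {i} → i ∈ m ∷ rest → h′ i ∈ S i
      h′∈ {i} i∈ with i ≟ᴵ m
      h′∈     i∈         | yes refl = proj₁ (proj₂ new)
      h′∈ (here i≡m)     | no i≢m = ⊥-elim (i≢m i≡m)
      h′∈ (there i∈)     | no i≢m = h∈ i∈
      clash : ∀ {i} → i ∈ m ∷ rest → ¬ i ≡ m → ¬ proj₁ new ≡ h i
      clash (here i≡m)  i≢m eq = i≢m i≡m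
      clash (there i∈)  i≢m eq = proj₂ (proj₂ new) (subst (_∈ map h rest) (sym eq) (∈-map⁺ h i∈))
      h′-inj : ∀ {i j} → i ∈ m ∷ rest → j ∈ m ∷ rest → h′ i ≡ h′ j → i ≡ j
      h′-inj {i} {j} i∈ j∈ eq with i ≟ᴵ m | j ≟ᴵ m
      h′-inj i∈ j∈ eq | yes i≡m | yes j≡m = trans i≡m (sym j≡m)
      h′-inj i∈ j∈ eq | yes i≡m | no  j≢m = ⊥-elim (clash j∈ j≢m eq)
      h′-inj i∈ j∈ eq | no  i≢m | yes j≡m = ⊥-elim (clash i∈ i≢m (sym eq))
      h′-inj (here i≡m) j∈ eq | no i≢m | no j≢m = ⊥-elim (i≢m i≡m)
      h′-inj (there i∈) (here j≡m) eq | no i≢m | no j≢m = ⊥-elim (j≢m j≡m)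
      h′-inj (there i∈) (there j∈) eq | no i≢m | no j≢m = h-inj i∈ j∈ eq

  -- Auxiliary facts on lists and natural falling factorials.

  Unique-prefix : ∀ {xs : List A} ys {zs} → Unique xs → xs ↭ ys ++ zs → Unique ys
  Unique-prefix {A = A} ys uniq xs↭ = prefix ys (↭ₛ.Unique-resp-↭ (setoid A) (↭⇒↭ₛ xs↭) uniq)
    where
    prefix : ∀ ys {zs} → Unique (ys ++ zs) → Unique ys
    prefix []       _          = []
    prefix (y ∷ ys) (y∉ ∷ un) = All.tabulate (λ z∈ → All.lookup y∉ (∈-++⁺ˡ z∈)) ∷ prefix ys un

  restrict-all : ∀ (p : A → Bool) {k} (μ : Vec Bool k) S → (∀ {x} → x ∈ toList S → T (p x)) →
    T (all p (toList (restrict μ S)))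
  restrict-all p []          []      pS = _
  restrict-all p (true  ∷ μ) (x ∷ S) pS = Equivalence.from T-∧ (pS (here refl) , restrict-all p μ S (pS ∘ there))
  restrict-all p (false ∷ μ) (x ∷ S) pS = restrict-all p μ S (pS ∘ there)

  length-allFin : ∀ n → length (allFin n) ≡ n
  length-allFin n = length-tabulate id

  falling-pos : ∀ {d n} → d ≤ n → 0 < falling n d
  falling-pos {zero}  d≤n = z<s
  falling-pos {suc d} {n} d<n = *-mono-≤ (m<n⇒0<n∸m d<n) (falling-pos (<⇒≤ d<n))

  falling-mono-≤ : ∀ d {m n} → m ≤ n → falling m d ≤ falling n d
  falling-mono-≤ zero    m≤n = ≤-refl
  falling-mono-≤ (suc d) m≤n = *-mono-≤ (∸-monoˡ-≤ d m≤n) (falling-mono-≤ d m≤n)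

  falling-< : ∀ {n d} → n < d → falling n d ≡ 0
  falling-< {n} {suc d} n<d = cong (_* falling n d) (m≤n⇒m∸n≡0 (s≤s⁻¹ n<d))

  -- Neighbourhoods and degrees.

  neighbours : ∀ G → Fin (n₁ G) → List (Fin (n₂ G))
  neighbours G v = filterᵇ (adj G v) (allFin (n₂ G))

  commonNeighbours : ∀ G {k} → Vec (Fin (n₂ G)) k → List (Fin (n₁ G))
  commonNeighbours G S = filterᵇ (λ v → all (adj G v) (toList S)) (allFin (n₁ G))

  deg₁≡∣neighbours∣ : ∀ G v → deg₁ G v ≡ length (neighbours G v)
  deg₁≡∣neighbours∣ G v = trans (∑-filterᵇ (adj G v) 1 (allFin (n₂ G))) (*-identityʳ _)

  deg₁≡trues : ∀ G v → deg₁ G v ≡ trues (tabulate (adj G v))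
  deg₁≡trues G v = trans (cong sum (map-tabulate id (λ j → if adj G v j then 1 else 0))) (go (adj G v))
    where
    go : ∀ {n} (p : Fin n → Bool) → sum (List.tabulate (λ j → if p j then 1 else 0)) ≡ trues (tabulate p)
    go {zero}  p = refl
    go {suc n} p with p zero
    ... | true  = cong suc (go (p ∘ suc))
    ... | false = go (p ∘ suc)

  ∣common∣≤n₁ : ∀ G {k} (S : Vec (Fin (n₂ G)) k) → length (commonNeighbours G S) ≤ n₁ G
  ∣common∣≤n₁ G S = ≤-trans (length-filter _ (allFin (n₁ G))) (≤-reflexive (length-allFin (n₁ G)))

  -- Averaging over base vertices and over injections.

  module _ (G : BipGraph) where

    L : ℕ
    L = n₁ G !

    cost : ∀ {k} → Vec (Fin (n₂ G)) k → ℕ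
    cost S = share L (length (commonNeighbours G S))

    -- Double counting: after exchanging the sums, a tuple S appears once for each of its common
    -- neighbours, and these appearances cost at most L together.
    ∑-cost-≤ : ∀ d → ∑ (λ v → injSum d cost (neighbours G v)) (allFin (n₁ G)) ≤ L * falling (n₂ G) d
    ∑-cost-≤ d = begin
      ∑ (λ v → injSum d cost (neighbours G v)) V₁
        ≡⟨ ∑-cong (λ v → injSum-filterᵇ d (adj G v) cost V₂) V₁ ⟩
      ∑ (λ v → injSum d (λ S → if all (adj G v) (toList S) then cost S else 0) V₂) V₁
        ≡⟨ injSum-∑ d (λ v S → if all (adj G v) (toList S) then cost S else 0) V₁ V₂ ⟨
      injSum d (λ S → ∑ (λ v → if all (adj G v) (toList S) then cost S else 0) V₁) V₂
        ≡⟨ injSum-cong d V₂ (λ S → ∑-filterᵇ (λ v → all (adj G v) (toList S)) (cost S) V₁) ⟩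
      injSum d (λ S → length (commonNeighbours G S) * cost S) V₂
        ≤⟨ injSum-mono-≤ d V₂ (λ S → ≤-trans (*-share-≤ L (length (commonNeighbours G S)))
             (≤-reflexive (sym (*-identityʳ L)))) ⟩
      injSum d (λ S → L * 1) V₂
        ≡⟨ injSum-*ˡ L d (λ _ → 1) V₂ ⟩
      L * injSum d (λ S → 1) V₂
        ≡⟨ cong (L *_) (trans (injSum-1 d V₂) (cong (λ n → falling n d) (length-allFin (n₂ G)))) ⟩
      L * falling (n₂ G) d ∎
      where
      open ≤-Reasoning
      V₁ = allFin (n₁ G)
      V₂ = allFin (n₂ G)

    -- First-moment argument. Restricting a uniform injection to d fixed coordinates gives a uniform
    -- injective d-tuple, so by linearity the mean total cost is n times the mean of `cost`, at most
    -- L by the last hypothesis.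
    ∃-cheap-injection : ∀ {w d n} (μ : Fin n → Vec Bool w) → (∀ i → trues (μ i) ≡ d) → ∀ us → w ≤ length us → d ≤ w →
      n * injSum d cost us ≤ L * falling (length us) d →
      ∃[ f ] ∃[ rest ] us ↭ toList f ++ rest × ∑ (λ i → cost (restrict (μ i) f)) (allFin n) ≤ L
    ∃-cheap-injection {w} {d} {n} μ trues≡ us w≤ d≤w average =
      -- Multiplication by D, positive since d ≤ w ≤ length us, clears the denominator of the mean.
      injSum-≤-∃ w _ (λ _ → L) us w≤ (*-cancelˡ-≤ D {{>-nonZero (falling-pos (≤-trans d≤w w≤))}} (begin
        D * injSum w (λ f → ∑ (λ i → cost (restrict (μ i) f)) (allFin n)) us
          ≡⟨ cong (D *_) (injSum-∑ w (λ i f → cost (restrict (μ i) f)) (allFin n) us) ⟩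
        D * ∑ (λ i → injSum w (λ f → cost (restrict (μ i) f)) us) (allFin n)
          ≡⟨ ∑-*ˡ D _ (allFin n) ⟨
        ∑ (λ i → D * injSum w (λ f → cost (restrict (μ i) f)) us) (allFin n)
          ≡⟨ ∑-cong share-of (allFin n) ⟩
        ∑ (λ i → W * Y) (allFin n)
          ≡⟨ trans (∑-const (W * Y) (allFin n)) (cong (_* (W * Y)) (length-allFin n)) ⟩
        n * (W * Y)
          ≡⟨ solve 3 (λ n w y → n :* (w :* y) := w :* (n :* y)) refl n W Y ⟩
        W * (n * Y)
          ≤⟨ *-monoʳ-≤ W average ⟩
        W * (L * D)
          ≡⟨ solve 3 (λ w l d → w :* (l :* d) := d :* (l :* w)) refl W L D ⟩
        D * (L * W)
          ≡⟨ cong (D *_) (injSum-*ˡ L w (λ _ → 1) us) ⟨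
        D * injSum w (λ _ → L * 1) us
          ≡⟨ cong (D *_) (injSum-cong w us (λ _ → *-identityʳ L)) ⟩
        D * injSum w (λ _ → L) us ∎))
      where
      open ≤-Reasoning
      open +-*-Solver
      D = falling (length us) d
      W = injSum w (λ _ → 1) us
      Y = injSum d cost us
      -- The number c of extensions is the same for `cost` and for the constant 1; the latter gives
      -- W = cD, which eliminates c.
      share-of : ∀ i → D * injSum w (λ f → cost (restrict (μ i) f)) us ≡ W * Y
      share-of i with injSum-restrict {A = Fin (n₂ G)} (μ i) (length us)
      ... | c , eq = begin-equality
        D * injSum w (λ f → cost (restrict (μ i) f)) us
          ≡⟨ cong (D *_) (trans (eq cost us refl) (cong (λ k → c * injSum k cost us) (trues≡ i))) ⟩
        D * (c * Y)
          ≡⟨ solve 3 (λ d c y → d :* (c :* y) := c :* d :* y) refl D c Y ⟩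
        c * D * Y
          ≡⟨ cong (_* Y) (trans (eq (λ _ → 1) us refl)
             (trans (cong (λ k → c * injSum k (λ _ → 1) us) (trues≡ i)) (cong (c *_) (injSum-1 d us)))) ⟨
        W * Y ∎

  -- From averages to a copy of H.

  embedding : ∀ (G H : BipGraph) (h : Fin (n₁ H) → Fin (n₁ G)) (f : Fin (n₂ H) → Fin (n₂ G)) →
    Injective _≡_ _≡_ h → Injective _≡_ _≡_ f → (∀ i j → T (adj H i j) → T (adj G (h i) (f j))) → ContainsCopy G H
  embedding G H h f h-inj f-inj edge = g , g-inj , g-adj
    where
    g : Vert H → Vert G
    g (inj₁ i) = inj₁ (h i)
    g (inj₂ j) = inj₂ (f j)
    g-inj : Injective _≡_ _≡_ g
    g-inj {inj₁ i} {inj₁ j} eq = cong inj₁ (h-inj (inj₁-injective eq))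
    g-inj {inj₂ i} {inj₂ j} eq = cong inj₂ (f-inj (inj₂-injective eq))
    g-adj : ∀ u v → Adj H u v → Adj G (g u) (g v)
    g-adj (inj₁ i) (inj₂ j) = edge i j
    g-adj (inj₂ j) (inj₁ i) = edge i j

  -- A cheap injection of W₂ into N(v) makes the reciprocals of the candidate sets sum to at most 1,
  -- so W₁ can be placed by distinct representatives.
  embedding-into-neighbourhood : ∀ G H d → (∀ i → deg₁ H i ≤ d) → d ≤ n₂ H →
    ∀ v → n₂ H ≤ deg₁ G v → n₁ H * injSum d (cost G) (neighbours G v) ≤ n₁ G ! * falling (deg₁ G v) d →
    ContainsCopy G H
  embedding-into-neighbourhood G H d deg≤d d≤w v w≤deg average =
    embedding G H (proj₁ choice) (lookup f)
      (λ {i} {j} → proj₂ (proj₂ choice) (∈-allFin i) (∈-allFin j))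
      (λ {i} {j} → Unique-lookup-injective f f-unique i j)
      -- The representative of i is adjacent to all images marked by the padded mask, hence to the
      -- images of the neighbours of i.
      (λ i j ij → all-restrict _ (μ i) f
         (proj₂ (∈-filter⁻ (T? ∘ (λ u → all (adj G u) (toList (restrict (μ i) f))))
            {xs = allFin (n₁ G)} (proj₁ (proj₂ choice) (∈-allFin i))))
         j (proj₂ (proj₂ (mask i)) j (subst T (sym (lookup∘tabulate (adj H i) j)) ij)))
    where
    mask : ∀ i → ∃[ ν ] trues ν ≡ d × (∀ j → T (lookup (tabulate (adj H i)) j) → T (lookup ν j))
    mask i = enlarge (tabulate (adj H i)) d (subst (_≤ d) (deg₁≡trues H i) (deg≤d i)) d≤w
    μ : Fin (n₁ H) → Vec Bool (n₂ H)
    μ i = proj₁ (mask i)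
    cheap = ∃-cheap-injection G μ (λ i → proj₁ (proj₂ (mask i))) (neighbours G v)
      (subst (n₂ H ≤_) (deg₁≡∣neighbours∣ G v) w≤deg) d≤w
      (subst (λ k → n₁ H * injSum d (cost G) (neighbours G v) ≤ n₁ G ! * falling k d) (deg₁≡∣neighbours∣ G v) average)
    f : Vec (Fin (n₂ G)) (n₂ H)
    f = proj₁ cheap
    nbrs↭ = proj₁ (proj₂ (proj₂ cheap))
    f-unique : Unique (toList f)
    f-unique = Unique-prefix (toList f) (Unique.filter⁺ (T? ∘ adj G v) (Unique.allFin⁺ (n₂ G))) nbrs↭
    S : Fin (n₁ H) → List (Fin (n₁ G))
    S i = commonNeighbours G (restrict (μ i) f)
    -- The base vertex is adjacent to the whole image of W₂, so no candidate set is empty.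
    v∈S : ∀ i → v ∈ S i
    v∈S i = ∈-filter⁺ (T? ∘ (λ u → all (adj G u) (toList (restrict (μ i) f)))) (∈-allFin v)
      (restrict-all (adj G v) (μ i) f
        (λ x∈f → proj₂ (∈-filter⁻ (T? ∘ adj G v) {xs = allFin (n₂ G)} (∈-resp-↭ (↭-sym nbrs↭) (∈-++⁺ˡ x∈f)))))
    ∈⇒0<length : ∀ {A : Set} {x : A} {xs} → x ∈ xs → 0 < length xs
    ∈⇒0<length (here _)  = z<s
    ∈⇒0<length (there _) = z<s
    choice = injective-choice Fin._≟_ Fin._≟_ (n₁ G) S
      (λ i → Unique.filter⁺ (T? ∘ (λ u → all (adj G u) (toList (restrict (μ i) f)))) (Unique.allFin⁺ (n₁ G)))
      (λ i → ∈⇒0<length (v∈S i)) (λ i → ∣common∣≤n₁ G (restrict (μ i) f)) v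
      (length (allFin (n₁ H))) (allFin (n₁ H)) refl (proj₂ (proj₂ (proj₂ cheap)))

  -- With `w` = ∣W₂∣, these are the base vertices whose neighbourhood has room for W₂.
  largeVertices : (G : BipGraph) → ℕ → List (Fin (n₁ G))
  largeVertices G w = filter (λ v → w ≤? deg₁ G v) (allFin (n₁ G))

  -- Selects the base vertex: dropping small vertices only lowers the total cost bounded by
  -- `∑-cost-≤`, so averaging over the large ones finds a suitable v.
  embedding-from-falling-sum : ∀ G H d → (∀ i → deg₁ H i ≤ d) → d ≤ n₂ H →
    let S = ∑ (λ v → falling (deg₁ G v) d) (largeVertices G (n₂ H)) in
    0 < S → n₁ H * falling (n₂ G) d ≤ S → ContainsCopy G H
  embedding-from-falling-sum G H d deg≤d d≤w 0<S bound
    with ∑-≤-∃ (λ v → n₁ H * injSum d (cost G) (neighbours G v)) (λ v → n₁ G ! * falling (deg₁ G v) d)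
           large (nonempty large 0<S) (begin
      ∑ (λ v → n₁ H * Y v) large
        ≡⟨ ∑-*ˡ (n₁ H) Y large ⟩
      n₁ H * ∑ Y large
        ≤⟨ *-monoʳ-≤ (n₁ H) (≤-trans (∑-filter-≤ (λ v → n₂ H ≤? deg₁ G v) Y (allFin (n₁ G))) (∑-cost-≤ G d)) ⟩
      n₁ H * (n₁ G ! * falling (n₂ G) d)
        ≡⟨ solve 3 (λ n l m → n :* (l :* m) := l :* (n :* m)) refl (n₁ H) (n₁ G !) (falling (n₂ G) d) ⟩
      n₁ G ! * (n₁ H * falling (n₂ G) d)
        ≤⟨ *-monoʳ-≤ (n₁ G !) bound ⟩
      n₁ G ! * ∑ (λ v → falling (deg₁ G v) d) large
        ≡⟨ ∑-*ˡ (n₁ G !) _ large ⟨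
      ∑ (λ v → n₁ G ! * falling (deg₁ G v) d) large ∎)
    where
    open ≤-Reasoning
    open +-*-Solver
    large = largeVertices G (n₂ H)
    Y : Fin (n₁ G) → ℕ
    Y v = injSum d (cost G) (neighbours G v)
    -- Averaging needs at least one large vertex, supplied by the positive falling sum.
    nonempty : ∀ vs → 0 < ∑ (λ v → falling (deg₁ G v) d) vs → 0 < length vs
    nonempty (_ ∷ _) _ = z<s
  ... | v , v∈ , average = embedding-into-neighbourhood G H d deg≤d d≤w v
    (proj₂ (∈-filter⁻ (λ v → n₂ H ≤? deg₁ G v) {xs = allFin (n₁ G)} v∈)) average

module Embedding where

  open FallingFactorials
  open Counting
  open import Data.Empty using (⊥; ⊥-elim)
  open import Data.Fin as Fin using (Fin)
  open import Data.Fin.Properties using (inject≤-injective; ¬Fin0)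
  open import Data.List using (length; allFin)
  open import Data.List.Properties using (length-filter)
  open import Data.Nat as ℕ using (ℕ; zero; suc; NonZero)
  import Data.Nat.Properties as ℕₚ
  open import Data.Product using (_,_)
  open import Data.Rational hiding (NonZero)
  open import Data.Rational.Properties
  open import Data.Rational.Solver using (module +-*-Solver)
  open import Data.Sum using ([_,_]′)
  open import Relation.Binary.PropositionalEquality using (_≡_; refl; sym; trans; cong; subst)
  open +-*-Solver

  -- Degree sums bounded through the density.

  1^ℚ : ∀ d → 1ℚ ^ℚ d ≡ 1ℚ
  1^ℚ zero    = refl
  1^ℚ (suc d) = trans (*-identityˡ _) (1^ℚ d)

  ^ℚ-≤1 : ∀ {x} d → 0ℚ ≤ x → x ≤ 1ℚ → x ^ℚ d ≤ 1ℚ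
  ^ℚ-≤1 {x} d 0≤x x≤1 = subst (x ^ℚ d ≤_) (1^ℚ d) (^ℚ-mono-≤ d 0≤x x≤1)

  edges≤ : ∀ G → edges G ℕ.≤ n₁ G ℕ.* n₂ G
  edges≤ G = begin
    ∑ (deg₁ G) (allFin (n₁ G))     ≤⟨ ∑-mono-≤ deg≤ (allFin (n₁ G)) ⟩
    ∑ (λ _ → n₂ G) (allFin (n₁ G)) ≡⟨ ∑-const (n₂ G) (allFin (n₁ G)) ⟩
    length (allFin (n₁ G)) ℕ.* n₂ G ≡⟨ cong (ℕ._* n₂ G) (length-allFin (n₁ G)) ⟩
    n₁ G ℕ.* n₂ G                  ∎
    where
    open ℕₚ.≤-Reasoning
    deg≤ : ∀ v → deg₁ G v ℕ.≤ n₂ G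
    deg≤ v = ℕₚ.≤-trans (ℕₚ.≤-reflexive (deg₁≡∣neighbours∣ G v))
      (ℕₚ.≤-trans (length-filter _ (allFin (n₂ G))) (ℕₚ.≤-reflexive (length-allFin (n₂ G))))

  density≤1 : ∀ {α} G → 0 ℕ.< n₁ G → 0 ℕ.< n₂ G → α * toℚ (n₁ G) * toℚ (n₂ G) ≤ toℚ (edges G) → α ≤ 1ℚ
  density≤1 {α} G 0<n₁ 0<n₂ dense = *-cancelˡ-≤-0< (x * y) (0<* (0<toℚ 0<n₁) (0<toℚ 0<n₂)) (begin
    x * y * α      ≡⟨ solve 3 (λ x y α → x :* y :* α := α :* x :* y) refl x y α ⟩
    α * x * y      ≤⟨ dense ⟩
    toℚ (edges G)  ≤⟨ toℚ-mono-≤ {edges G} {n₁ G ℕ.* n₂ G} (edges≤ G) ⟩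
    toℚ (n₁ G ℕ.* n₂ G) ≡⟨ toℚ-* (n₁ G) (n₂ G) ⟩
    x * y          ≡⟨ *-identityʳ (x * y) ⟨
    x * y * 1ℚ     ∎)
    where
    open ≤-Reasoning
    x = toℚ (n₁ G)
    y = toℚ (n₂ G)

  -- Sums the supporting line at `a` over all degrees. A lower bound `a` for the average degree
  -- suffices, because the slope is nonnegative.
  falling-sum-jensen : ∀ G d {a} → toℚ d ≤ a → a * toℚ (n₁ G) ≤ toℚ (edges G) →
    toℚ (n₁ G) * fallingℚ d a ≤ toℚ (∑ (λ v → falling (deg₁ G v) d) (allFin (n₁ G)))
  falling-sum-jensen G d {a} d≤a average with falling-tangent d d≤a
  ... | s , 0≤s , below = begin
    N * g
      ≤⟨ ≤-from-gap {N * g} (s * (toℚ (edges G) - a * N)) (0≤* 0≤s (0≤q-p average))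
           (solve 5 (λ N g s a e → N :* (g :- s :* a) :+ s :* e := N :* g :+ s :* (e :- a :* N))
             refl N g s a (toℚ (edges G))) ⟩
    N * (g - s * a) + s * toℚ (edges G)
      ≡⟨ cong (λ l → toℚ l * (g - s * a) + s * toℚ (edges G)) (length-allFin (n₁ G)) ⟨
    toℚ (length (allFin (n₁ G))) * (g - s * a) + s * toℚ (edges G)
      ≤⟨ sum-mono-linear (g - s * a) s (deg₁ G) (λ v → falling (deg₁ G v) d) pointwise (allFin (n₁ G)) ⟩
    toℚ (∑ (λ v → falling (deg₁ G v) d) (allFin (n₁ G))) ∎
    where
    open ≤-Reasoning
    N = toℚ (n₁ G)
    g = fallingℚ d a
    pointwise : ∀ v → (g - s * a) + s * toℚ (deg₁ G v) ≤ toℚ (falling (deg₁ G v) d)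
    pointwise v = subst (_≤ toℚ (falling (deg₁ G v) d))
      (solve 4 (λ g s a n → g :+ s :* (n :- a) := (g :- s :* a) :+ s :* n) refl g s a (toℚ (deg₁ G v)))
      (below (deg₁ G v))

  falling-sum-large : ∀ G d w → let f = λ v → falling (deg₁ G v) d in
    ∑ f (allFin (n₁ G)) ℕ.≤ ∑ f (largeVertices G w) ℕ.+ n₁ G ℕ.* falling w d
  falling-sum-large G d w = subst
    (λ l → ∑ f (allFin (n₁ G)) ℕ.≤ ∑ f (largeVertices G w) ℕ.+ l ℕ.* falling w d) (length-allFin (n₁ G))
    (∑-≤-filter (λ v → w ℕ.≤? deg₁ G v) f (falling w d)
      (λ v w≰deg → falling-mono-≤ d (ℕₚ.<⇒≤ (ℕₚ.≰⇒> w≰deg))) (allFin (n₁ G)))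
    where
    f : Fin (n₁ G) → ℕ
    f v = falling (deg₁ G v) d

  -- Jensen at α∣V₂∣, with small vertices discarded, bounds the large-vertex sum from below. Scaled
  -- by 1 + ε and added to ∣V₁∣ times `falling-inequality`, it makes the terms in (w)_d cancel.
  falling-sum-bound : ∀ G d {ε α} w → 0ℚ ≤ ε → 0ℚ < α → α ≤ 1ℚ → 0 ℕ.< w → d ℕ.≤ w →
    toℚ w ≤ α * (α * toℚ (n₂ G)) →
    α * toℚ (n₁ G) * toℚ (n₂ G) ≤ toℚ (edges G) →
    (1ℚ + ε) * toℚ w ^ℚ d ≤ ε * (α * (α * toℚ (n₂ G))) ^ℚ d →
    toℚ w ^ℚ d ≤ (1ℚ + ε) * toℚ (falling w d) →
    toℚ (n₁ G) * (α ^ℚ d * fallingℚ d (toℚ (n₂ G))) ≤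
    (1ℚ + ε) * toℚ (∑ (λ v → falling (deg₁ G v) d) (largeVertices G w))
  falling-sum-bound G d {ε} {α} w 0≤ε 0<α α≤1 0<w d≤w w≤b dense ew≤εb w≤eg =
    ≤-from-gap (N * (e * g a - (t + e * g x)) + e * (S + N * g x - N * g a))
      (0≤+ (0≤* 0≤N (0≤q-p key)) (0≤* 0≤e (0≤q-p split)))
      (solve 6 (λ N e ga t gx S → e :* S := N :* t :+ (N :* (e :* ga :- (t :+ e :* gx)) :+ e :* (S :+ N :* gx :- N :* ga)))
        refl N e (g a) t (g x) S)
    where
    M = toℚ (n₂ G)
    N = toℚ (n₁ G)
    x = toℚ w
    a = α * M
    e = 1ℚ + ε
    g : ℚ → ℚ
    g = fallingℚ d
    t = α ^ℚ d * g M
    S = toℚ (∑ (λ v → falling (deg₁ G v) d) (largeVertices G w))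
    0≤N = 0≤toℚ (n₁ G)
    0≤e : 0ℚ ≤ e
    0≤e = 0≤+ (nonNegative⁻¹ 1ℚ) 0≤ε
    d≤x : toℚ d ≤ x
    d≤x = toℚ-mono-≤ {d} {w} d≤w
    0≤a : 0ℚ ≤ a
    0≤a = 0≤* (<⇒≤ 0<α) (0≤toℚ (n₂ G))
    d≤a : toℚ d ≤ a
    d≤a = ≤-trans d≤x (≤-trans w≤b (shrink-≤ α≤1 0≤a))
    g≡ : toℚ (falling w d) ≡ g x
    g≡ = falling≡fallingℚ d d≤w
    key : t + e * g x ≤ e * g a
    key = falling-inequality d 0≤ε 0<α α≤1 (0<toℚ 0<w) d≤x w≤b ew≤εb (subst (λ z → x ^ℚ d ≤ e * z) g≡ w≤eg)
    split : N * g a ≤ S + N * g x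
    split = begin
      N * g a
        ≤⟨ falling-sum-jensen G d d≤a (subst (_≤ toℚ (edges G))
             (solve 3 (λ α n m → α :* n :* m := α :* m :* n) refl α N M) dense) ⟩
      toℚ (∑ (λ v → falling (deg₁ G v) d) (allFin (n₁ G)))
        ≤⟨ toℚ-mono-≤ {∑ (λ v → falling (deg₁ G v) d) (allFin (n₁ G))} (falling-sum-large G d w) ⟩
      toℚ (∑ (λ v → falling (deg₁ G v) d) (largeVertices G w) ℕ.+ n₁ G ℕ.* falling w d)
        ≡⟨ trans (toℚ-+ (∑ (λ v → falling (deg₁ G v) d) (largeVertices G w)) _)
             (cong (S +_) (trans (toℚ-* (n₁ G) (falling w d)) (cong (N *_) g≡))) ⟩
      S + N * g x ∎
      where open ≤-Reasoning

  -- The embedding theorem: the degenerate case and the assembly.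

  embedding-of-empty-part : ∀ G H → n₂ H ≡ 0 → n₁ H ℕ.≤ n₁ G → ContainsCopy G H
  embedding-of-empty-part G H w≡0 n≤n = embedding G H (λ i → Fin.inject≤ i n≤n) (λ j → ⊥-elim (empty j))
    (inject≤-injective n≤n n≤n _ _) (λ {j} → ⊥-elim (empty j)) (λ i j → ⊥-elim (empty j))
    where
    empty : Fin (n₂ H) → ⊥
    empty j = ¬Fin0 (subst Fin w≡0 j)

  bipartite-embedding : (d : ℕ) → .{{NonZero d}} → (ε α : ℚ) → Positive ε → Positive α →
      (H G : BipGraph) →
      (∀ (i : Fin (n₁ H)) → deg₁ H i ℕ.≤ d) →
      NonZero (n₁ G) → NonZero (n₂ G) →
      α * toℚ (n₁ G) * toℚ (n₂ G) ≤ toℚ (edges G) →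
      (1ℚ + ε) * toℚ (n₁ H) ≤ (α ^ℚ d) * toℚ (n₁ G) →
      (1ℚ + ε) * (toℚ (n₂ H) ^ℚ d) ≤ ε * (α ^ℚ (2 ℕ.* d)) * (toℚ (n₂ G) ^ℚ d) →
      toℚ (n₂ H) ^ℚ d ≤ (1ℚ + ε) * toℚ (falling (n₂ H) d) →
      ContainsCopy G H
  bipartite-embedding d ε α ε-pos α-pos H G deg≤d n₁≢0 n₂≢0 dense W₁-small W₂-small ratio =
    [ many , few ]′ (ℕₚ.≤-<-connex d (n₂ H))
    where
    open ≤-Reasoning
    S = ∑ (λ v → falling (deg₁ G v) d) (largeVertices G (n₂ H))
    M = toℚ (n₂ G)
    b = α * (α * M)
    e = 1ℚ + ε
    0<n₁ = ℕ.>-nonZero⁻¹ (n₁ G) {{n₁≢0}}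
    0<n₂ = ℕ.>-nonZero⁻¹ (n₂ G) {{n₂≢0}}
    0<ε = positive⁻¹ ε {{ε-pos}}
    0<α = positive⁻¹ α {{α-pos}}
    0≤α = <⇒≤ 0<α
    α≤1 = density≤1 G 0<n₁ 0<n₂ dense
    0<e : 0ℚ < e
    0<e = +-mono-< (positive⁻¹ 1ℚ) 0<ε
    0<b = 0<* 0<α (0<* 0<α (0<toℚ 0<n₂))
    -- Rewrites the size condition on V₂, given in d-th powers to avoid roots, in terms of b =
    -- α²∣V₂∣.
    b^d≡ : ε * (α ^ℚ (2 ℕ.* d)) * M ^ℚ d ≡ ε * b ^ℚ d
    b^d≡ = trans (*-assoc ε _ _) (cong (ε *_) (begin-equality
      α ^ℚ (2 ℕ.* d) * M ^ℚ d      ≡⟨ cong (_* M ^ℚ d) (^ℚ-double α d) ⟩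
      α ^ℚ d * α ^ℚ d * M ^ℚ d     ≡⟨ *-assoc (α ^ℚ d) _ _ ⟩
      α ^ℚ d * (α ^ℚ d * M ^ℚ d)   ≡⟨ cong (α ^ℚ d *_) (^ℚ-distrib-* α M d) ⟨
      α ^ℚ d * (α * M) ^ℚ d        ≡⟨ ^ℚ-distrib-* α (α * M) d ⟨
      b ^ℚ d                       ∎))
    ew≤εb : e * toℚ (n₂ H) ^ℚ d ≤ ε * b ^ℚ d
    ew≤εb = subst (e * toℚ (n₂ H) ^ℚ d ≤_) b^d≡ W₂-small
    -- Enlarging ε to 1 + ε on the right lets the factor cancel, and d > 0 allows d-th roots to be
    -- compared.
    w≤b : toℚ (n₂ H) ≤ b
    w≤b = ^ℚ-cancel-≤ d 0<b (*-cancelˡ-≤-0< e 0<e (≤-trans ew≤εb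
      (≤-from-gap {ε * b ^ℚ d} (b ^ℚ d) (^ℚ-nonneg d (<⇒≤ 0<b))
        (solve 2 (λ ε b → (con 1ℚ :+ ε) :* b := ε :* b :+ b) refl ε (b ^ℚ d)))))
    -- Below d the falling factorial vanishes, so the ratio hypothesis forces W₂ to be empty and
    -- only W₁ has to be placed.
    few : n₂ H ℕ.< d → ContainsCopy G H
    few w<d = embedding-of-empty-part G H w≡0 (toℚ-cancel-≤ {n₁ H} {n₁ G} (begin
        toℚ (n₁ H)               ≤⟨ ≤-from-gap {toℚ (n₁ H)} (ε * toℚ (n₁ H)) (0≤* (<⇒≤ 0<ε) (0≤toℚ (n₁ H)))
                                     (solve 2 (λ ε n → (con 1ℚ :+ ε) :* n := n :+ ε :* n) refl ε (toℚ (n₁ H))) ⟩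
        (1ℚ + ε) * toℚ (n₁ H)    ≤⟨ W₁-small ⟩
        α ^ℚ d * toℚ (n₁ G)      ≤⟨ *-monoʳ-≤-nonNeg (toℚ (n₁ G)) {{nonNegative (0≤toℚ (n₁ G))}}
                                     (^ℚ-≤1 d (<⇒≤ 0<α) α≤1) ⟩
        1ℚ * toℚ (n₁ G)          ≡⟨ *-identityˡ _ ⟩
        toℚ (n₁ G)               ∎))
      where
      w≡0 : n₂ H ≡ 0
      w≡0 = ℕₚ.n≤0⇒n≡0 (ℕₚ.≮⇒≥ λ 0<w → <-irrefl refl (<-≤-trans (^ℚ-pos d (0<toℚ 0<w)) (subst (toℚ (n₂ H) ^ℚ d ≤_)
        (trans (cong (λ k → e * toℚ k) (falling-< w<d)) (*-zeroʳ e)) ratio)))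
    many : d ℕ.≤ n₂ H → ContainsCopy G H
    many d≤w = embedding-from-falling-sum G H d deg≤d d≤w 0<S
      -- The size condition on V₁ carries the same factor 1 + ε as `bound`, so it cancels.
      (toℚ-cancel-≤ {n₁ H ℕ.* falling (n₂ G) d} {S} (*-cancelˡ-≤-0< e 0<e (begin
          e * toℚ (n₁ H ℕ.* falling (n₂ G) d)
            ≡⟨ trans (cong (e *_) (toℚ-* (n₁ H) (falling (n₂ G) d))) (sym (*-assoc e _ _)) ⟩
          e * toℚ (n₁ H) * toℚ (falling (n₂ G) d)
            ≤⟨ *-monoʳ-≤-nonNeg (toℚ (falling (n₂ G) d)) {{nonNegative (0≤toℚ (falling (n₂ G) d))}} W₁-small ⟩
          α ^ℚ d * toℚ (n₁ G) * toℚ (falling (n₂ G) d)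
            ≡⟨ cong (α ^ℚ d * toℚ (n₁ G) *_) (falling≡fallingℚ d d≤M) ⟩
          α ^ℚ d * toℚ (n₁ G) * fallingℚ d M
            ≡⟨ solve 3 (λ t n g → t :* n :* g := n :* (t :* g)) refl (α ^ℚ d) (toℚ (n₁ G)) (fallingℚ d M) ⟩
          toℚ (n₁ G) * (α ^ℚ d * fallingℚ d M)
            ≤⟨ bound ⟩
          e * toℚ S ∎)))
      where
      0<w : 0 ℕ.< n₂ H
      0<w = ℕₚ.≤-trans (ℕ.>-nonZero⁻¹ d) d≤w
      d≤M : d ℕ.≤ n₂ G
      d≤M = ℕₚ.≤-trans d≤w (toℚ-cancel-≤ {n₂ H} {n₂ G}
        (≤-trans w≤b (≤-trans (shrink-≤ α≤1 (0≤* 0≤α (0≤toℚ (n₂ G)))) (shrink-≤ α≤1 (0≤toℚ (n₂ G))))))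
      bound : toℚ (n₁ G) * (α ^ℚ d * fallingℚ d M) ≤ e * toℚ S
      bound = falling-sum-bound G d (n₂ H) (<⇒≤ 0<ε) 0<α α≤1 0<w d≤w w≤b dense ew≤εb ratio
      -- Taken from `bound`, whose left side is positive; the comparison with ∣W₁∣ (∣V₂∣)_d would
      -- not give it when W₁ is empty.
      0<S : 0 ℕ.< S
      0<S = ℕₚ.n≢0⇒n>0 λ S≡0 → <-irrefl refl (<-≤-trans
        (0<* (0<toℚ 0<n₁) (0<* (^ℚ-pos d 0<α) (fallingℚ-pos d (toℚ-mono-≤ {d} {n₂ G} d≤M))))
        (subst (toℚ (n₁ G) * (α ^ℚ d * fallingℚ d M) ≤_) (trans (cong (λ k → e * toℚ k) S≡0) (*-zeroʳ e)) bound))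

open import Data.Nat using (ℕ; _≤_) renaming (_*_ to _*ℕ_)
open import Data.Nat.Base using (NonZero)
open import Data.Fin using (Fin)
open import Data.Rational using (ℚ; Positive; _+_; _*_; 1ℚ) renaming (_≤_ to _≤ℚ_)

theorem2p3 : (d : ℕ) → .{{NonZero d}} → (ε α : ℚ) → Positive ε → Positive α →
    (H G : BipGraph) →
    (∀ (i : Fin (n₁ H)) → deg₁ H i ≤ d) →
    NonZero (n₁ G) → NonZero (n₂ G) →
    α * toℚ (n₁ G) * toℚ (n₂ G) ≤ℚ toℚ (edges G) →
    (1ℚ + ε) * toℚ (n₁ H) ≤ℚ (α ^ℚ d) * toℚ (n₁ G) →
    (1ℚ + ε) * (toℚ (n₂ H) ^ℚ d) ≤ℚ ε * (α ^ℚ (2 *ℕ d)) * (toℚ (n₂ G) ^ℚ d) →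
    toℚ (n₂ H) ^ℚ d ≤ℚ (1ℚ + ε) * toℚ (falling (n₂ H) d) →
    ContainsCopy G H
theorem2p3 = Embedding.bipartite-embedding
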